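{- Let $\sigma=\lambda/\nu$ be a balanced skew shape of height $a$ and width $b$, and let $w\in\mathfrak{S}_n$ be a skew vexillary permutation of shape $\sigma$. Then $\mathrm{ddeg}$ is $ab/(a+b)$-mesic with respect to the action of rowmotion $\mathrm{row}$ on the weak order interval $[e,w]$; that is, the average of $\mathrm{ddeg}$ along every $\mathrm{row}$-orbit of $[e,w]$ is $ab/(a+b)$.
   Context: Weak order: For $w\in\mathfrak{S}_n$, $\mathrm{Inv}(w)=\{(i,j): 1\le i<j\le n,\ w(i)>w(j)\}$ and $\mathrm{Inv}^{ -1}(w)=\mathrm{Inv}(w^{ -1})$. Weak order on $\mathfrak{S}_n$ is: $u\le w$ iff $\mathrm{Inv}^{ -1}(u)\subseteq \mathrm{Inv}^{ -1}(w)$; equivalently, it is the partial order whose cover relations are $u\lessdot us_k$ with $u(k)<u(k+1)$, $s_k$ the simple transposition of $k,k+1$. $e$ is the identity; $[e,w]=\{u:e\le u\le w\}$. Every such interval is a finite semidistributive lattice. $\mathrm{ddeg}(p)$ is the number of elements of the poset covered by $p$. Rowmotion: A finite lattice $L$ is semidistributive if every element has a canonical join representation and a canonical meet representation (equivalently, $x\vee y=x\vee z$ implies $x\vee y=x\vee(y\wedge z)$, and dually). For such $L$ and a cover relation $x\lessdot y$, put $\gamma(x\lessdot y)=\min\{z\in L:x\vee z=y\}$, which exists and is join-irreducible. Let $D^\gamma(y)=\{\gamma(x\lessdot y): x\lessdot y\}$ and $U^\gamma(y)=\{\gamma(y\lessdot z): y\lessdot z\}$. Rowmotion is the map $\mathrm{row}\colon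 L\to L$ with $\mathrm{row}(y)$ the unique $x\in L$ such that $D^\gamma(x)=U^\gamma(y)$; it is well defined and invertible (known fact). Homomesy: For an invertible operator $\Phi\colon X\to X$ on a finite set $X$, a statistic $f\colon X\to\mathbb{R}$ is $c$-mesic if the average of $f$ along every $\Phi$-orbit equals $c$. Shapes: A diagram is a finite subset of $\mathbb{Z}^2$ of boxes $(i,j)$ in matrix coordinates ($i$ = row, increasing downwards; $j$ = column, increasing rightwards). A partition $\lambda$ is identified with its Young diagram $\{(i,j):1\le i\le \ell(\lambda),1\le j\le\lambda_i\}$. For partitions with $\nu_i\le\lambda_i$ for all $i$, the skew shape $\sigma=\lambda/\nu$ is the set difference of the Young diagrams. $\sigma$ is connected if the Hasse diagram of the poset on its boxes (with order induced from the componentwise order on $\mathbb{Z}^2$) is connected (in particular nonempty). A connected $\sigma$ has height $a$ and width $b$ if $[a]\times[b]$ is the smallest rectangle containing $\sigma$ up to translation. Translate $\sigma$ into $[a]\times[b]$; its main antidiagonal is the line joining the northeast and southwest corners of the boundary of this rectangle. A corner of $\sigma$ is a point where two line segments that are part of the boundary of $\sigma$ meet; it is outward if no box of $\sigma$ intersects both line segments (except at the corner point). (Equivalently, outward corners are the lattice points, at the southeast corner of position $(p,q)$, such that exactly three of $(p,q),(p,q+1),(p+1,q),(p+1,q+1)$ lie in $\sigma$; such a point is on the main antidiagonal iff $pb+qa=ab$.) $\sigma$ is balanced if it is connected and all its outward corners lie exactly on its main antidiagonal. Skew vexillary: The Rothe diagram of $w$ is $\{(i,w(j)):(i,j)\in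 \mathrm{Inv}(w)\}$. $w$ is skew vexillary of shape $\sigma$ if its Rothe diagram can be transformed to $\sigma$ by some permutation of rows and columns (rows and columns being permuted separately). -}

module Defs where

open import Data.Empty using (⊥-elim)
open import Data.Fin as Fin using (Fin; zero; suc; toℕ; inject₁)
open import Data.Fin.Induction using (<-weakInduction)
import Data.Fin.Properties as Finₚ
open import Data.Fin.Permutation as Perm
  using (Permutation′; _⟨$⟩ʳ_; _⟨$⟩ˡ_; flip; insert; remove; inverseˡ; inverseʳ)
open import Data.Integer using (+_; 1ℤ)
open import Data.List using (List; []; _∷_; length; filter; map; foldr; iterate;
  allFin; deduplicate; cartesianProductWith)
import Data.List.Membership.Setoid as Membership
import Data.List.Membership.Propositional.Properties as ∈ₚ
open import Data.List.Relation.Unary.All using (All)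
open import Data.List.Relation.Unary.Any as Any using (Any; here; there; any?)
open import Data.List.Relation.Unary.Any.Properties using (cartesianProductWith⁺)
open import Data.List.Relation.Unary.Linked using (Linked)
open import Data.Nat as ℕ using (ℕ; zero; suc; _+_; _*_; _≤_; _<_; _≥_; z≤n; NonZero; >-nonZero)
import Data.Nat.GeneralisedArithmetic as ℕ-Iterate
import Data.Nat.Properties as ℕₚ
open import Data.Product using (Σ; ∃; ∃₂; _×_; _,_; proj₁; proj₂)
open import Data.Product.Relation.Binary.Pointwise.NonDependent using (×-poset)
open import Data.Rational as ℚ using (ℚ; 0ℚ)
open import Function using (_∘_; _↔_; _⇔_; Inverse)
open import Level using (0ℓ)
open import Relation.Binary using (Rel; Poset; DecPoset; Setoid; IsDecPartialOrder; _Respects_;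
  tri<; tri≈; tri>)
import Relation.Binary.Construct.On as On
open import Relation.Binary.Construct.Closure.Equivalence using (EqClosure)
import Relation.Binary.Properties.Poset as PosetProperties
open import Relation.Binary.PropositionalEquality using (_≡_; refl; sym; trans; cong; subst; subst₂)
open import Relation.Nullary using (¬_; Dec; yes; no)
open import Relation.Nullary.Decidable using (map′; _×-dec_; _→-dec_; ¬?)
open import Relation.Unary using (Pred; Decidable; Satisfiable; _∈_; _⊆_; _∖_; _≐_)

module Order (P : Poset 0ℓ 0ℓ 0ℓ) where
  open Poset P using (Carrier) renaming (_≤_ to _⊑_)
  open PosetProperties P using () renaming (_<_ to _⊏_)

  infix 4 _⋖_

  _⋖_ : Rel Carrier 0ℓ
  x ⋖ y = x ⊏ y × (∀ z → ¬ (x ⊏ z × z ⊏ y))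

  -- x ∨ z = y
  IsJoin : Carrier → Carrier → Carrier → Set
  IsJoin x z y = x ⊑ y × z ⊑ y × (∀ t → x ⊑ t → z ⊑ t → y ⊑ t)

  IsMin : Pred Carrier 0ℓ → Carrier → Set
  IsMin S m = m ∈ S × (∀ z → z ∈ S → m ⊑ z)

  -- j = γ(x ⋖ y)
  IsLabel : Carrier → Carrier → Carrier → Set
  IsLabel x y j = IsMin (λ z → IsJoin x z y) j

  Dγ Uγ : Carrier → Pred Carrier 0ℓ
  Dγ y j = ∃ λ x → x ⋖ y × IsLabel x y j
  Uγ y j = ∃ λ z → y ⋖ z × IsLabel y z j

-- The second condition says that row y is the unique x with Dγ x = Uγ y.
record Rowmotion (P : Poset 0ℓ 0ℓ 0ℓ) : Set where
  open Poset P using (Carrier; _≈_; module Eq)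
  open Order P
  field
    row     : Inverse Eq.setoid Eq.setoid
    row-def : ∀ y x → (Inverse.to row y ≈ x) ⇔ (Dγ x ≐ Uγ y)

-- elements may list the same element more than once.
record FinitePoset : Set₁ where
  field
    decPoset : DecPoset 0ℓ 0ℓ 0ℓ
  open DecPoset decPoset public
    using (Carrier; _≈_; _≟_; poset; module Eq)
    renaming (_≤_ to _⊑_; _≤?_ to _⊑?_; ≤-respˡ-≈ to ⊑-respˡ-≈; ≤-respʳ-≈ to ⊑-respʳ-≈)
  open Membership Eq.setoid using () renaming (_∈_ to _∈ₗ_)
  field
    elements : List Carrier
    complete : ∀ x → x ∈ₗ elements

module _ (F : FinitePoset) where
  open FinitePoset F
  open Order poset
  open PosetProperties poset using (<-respˡ-≈; <-respʳ-≈) renaming (_<_ to _⊏_)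

  private
    _⊏?_ : ∀ x y → Dec (x ⊏ y)
    x ⊏? y = (x ⊑? y) ×-dec ¬? (x ≟ y)

  cover? : ∀ x y → Dec (x ⋖ y)
  cover? x y = (x ⊏? y) ×-dec
    map′ (λ none z (p , q) → none (Any.map (λ z≈t → <-respʳ-≈ z≈t p , <-respˡ-≈ z≈t q) (complete z)))
         (λ none some → let (t , pq) = Any.satisfied some in none t pq)
         (¬? (any? (λ z → (x ⊏? z) ×-dec (z ⊏? y)) elements))

  -- elements is exhaustive, so after removing duplicates this counts each
  -- lower cover exactly once.
  ddeg : Carrier → ℕ
  ddeg y = length (deduplicate _≟_ (filter (λ x → cover? x y) elements))

module _ (F : FinitePoset) where
  open FinitePoset F

  module _ {S : Pred Carrier 0ℓ} (S? : Decidable S) (resp : S Respects _≈_) where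

    private
      restrict : List Carrier → List (Σ Carrier S)
      restrict [] = []
      restrict (x ∷ xs) with S? x
      ... | yes x∈S = (x , x∈S) ∷ restrict xs
      ... | no  _   = restrict xs

      restrict-complete : ∀ {x} → S x → ∀ {xs} → Any (x ≈_) xs →
                          Any ((x ≈_) ∘ proj₁) (restrict xs)
      restrict-complete x∈S {t ∷ _} (here x≈t) with S? t
      ... | yes _  = here x≈t
      ... | no t∉S = ⊥-elim (t∉S (resp x≈t x∈S))
      restrict-complete x∈S {t ∷ _} (there p) with S? t
      ... | yes _ = there (restrict-complete x∈S p)
      ... | no  _ = restrict-complete x∈S p

    subposet : FinitePoset
    subposet = record
      { decPoset = On.decPoset decPoset (proj₁ {B = S})
      ; elements = restrict elements
      ; complete = λ (x , x∈S) → restrict-complete x∈S (complete x)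
      }

  interval : Carrier → Carrier → FinitePoset
  interval a b = subposet {S = λ u → a ⊑ u × u ⊑ b}
    (λ u → (a ⊑? u) ×-dec (u ⊑? b))
    (λ x≈y (p , q) → ⊑-respʳ-≈ x≈y p , ⊑-respˡ-≈ x≈y q)

module _ {n : ℕ} where

  Inv : Permutation′ n → Pred (Fin n × Fin n) 0ℓ
  Inv w (i , j) = i Fin.< j × (w ⟨$⟩ʳ j) Fin.< (w ⟨$⟩ʳ i)

  Inv⁻¹ : Permutation′ n → Pred (Fin n × Fin n) 0ℓ
  Inv⁻¹ w = Inv (flip w)

  infix 4 _≤ʷ_ _≤ʷ?_

  _≤ʷ_ : Rel (Permutation′ n) 0ℓ
  u ≤ʷ w = Inv⁻¹ u ⊆ Inv⁻¹ w

  _≤ʷ?_ : ∀ u w → Dec (u ≤ʷ w)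
  u ≤ʷ? w = map′ (λ f {p} → f (proj₁ p) (proj₂ p)) (λ f i j → f {i , j})
    (Finₚ.all? λ i → Finₚ.all? λ j → inv? (flip u) i j →-dec inv? (flip w) i j)
    where
    inv? : ∀ v i j → Dec ((i , j) ∈ Inv v)
    inv? v i j = (i Finₚ.<? j) ×-dec ((v ⟨$⟩ʳ j) Finₚ.<? (v ⟨$⟩ʳ i))

  private
    ≤ʷ-reflexive : ∀ {u w} → u Perm.≈ w → u ≤ʷ w
    ≤ʷ-reflexive {u} {w} u≈w {i , j} (i<j , q) =
      i<j , subst₂ Fin._<_ (sym (inv≡ j)) (sym (inv≡ i)) q
      where
      inv≡ : ∀ k → w ⟨$⟩ˡ k ≡ u ⟨$⟩ˡ k
      inv≡ k = trans (cong (w ⟨$⟩ˡ_) (trans (sym (inverseʳ u)) (u≈w (u ⟨$⟩ˡ k)))) (inverseˡ w)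

    increasing⇒inflationary : ∀ {m} (h : Fin m → Fin m) →
      (∀ {x y} → x Fin.< y → h x Fin.< h y) → ∀ x → x Fin.≤ h x
    increasing⇒inflationary {suc m} h mono = <-weakInduction (λ x → x Fin.≤ h x) z≤n
      λ i ih → ℕₚ.≤-<-trans (subst (_≤ toℕ (h (inject₁ i))) (Finₚ.toℕ-inject₁ i) ih)
                            (mono (ℕ.s≤s (ℕₚ.≤-reflexive (Finₚ.toℕ-inject₁ i))))

    inverse-increasing : ∀ {u w} → u ≤ʷ w → w ≤ʷ u → ∀ x → x Fin.≤ (w ⟨$⟩ˡ (u ⟨$⟩ʳ x))
    inverse-increasing {u} {w} u≤w w≤u =
      increasing⇒inflationary (λ x → w ⟨$⟩ˡ (u ⟨$⟩ʳ x)) (λ {x} {y} x<y →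
        same-order (u ⟨$⟩ʳ x) (u ⟨$⟩ʳ y)
          (subst (λ z → toℕ z < toℕ (u ⟨$⟩ˡ (u ⟨$⟩ʳ y))) (sym (inverseˡ u))
            (subst (λ z → toℕ x < toℕ z) (sym (inverseˡ u)) x<y)))
      where
      same-order : ∀ i j → (u ⟨$⟩ˡ i) Fin.< (u ⟨$⟩ˡ j) → (w ⟨$⟩ˡ i) Fin.< (w ⟨$⟩ˡ j)
      same-order i j p with Finₚ.<-cmp i j
      ... | tri≈ _ refl _ = ⊥-elim (ℕₚ.<-irrefl refl p)
      ... | tri> _ _ j<i = proj₂ (u≤w {j , i} (j<i , p))
      ... | tri< i<j _ _ with Finₚ.<-cmp (w ⟨$⟩ˡ i) (w ⟨$⟩ˡ j)
      ...   | tri< q _ _ = q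
      ...   | tri> _ _ q = ⊥-elim (ℕₚ.<-asym p (proj₂ (w≤u {i , j} (i<j , q))))
      ...   | tri≈ _ q _ = ⊥-elim (Finₚ.<⇒≢ i<j
                (trans (sym (inverseʳ w)) (trans (cong (w ⟨$⟩ʳ_) q) (inverseʳ w))))

    ≤ʷ-antisym : ∀ {u w} → u ≤ʷ w → w ≤ʷ u → u Perm.≈ w
    ≤ʷ-antisym {u} {w} u≤w w≤u x = trans (sym (inverseʳ w)) (cong (w ⟨$⟩ʳ_) fixed)
      where
      v = w ⟨$⟩ˡ (u ⟨$⟩ʳ x)
      fixed : v ≡ x
      fixed = Finₚ.≤-antisym
        (subst (v Fin.≤_) (trans (cong (u ⟨$⟩ˡ_) (inverseʳ w)) (inverseˡ u))
          (inverse-increasing {w} {u} w≤u u≤w v))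
        (inverse-increasing {u} {w} u≤w w≤u x)

  weakIsDecPartialOrder : IsDecPartialOrder (Perm._≈_ {n} {n}) _≤ʷ_
  weakIsDecPartialOrder = record
    { isPartialOrder = record
      { isPreorder = record
        { isEquivalence = record
          { refl  = λ _ → refl
          ; sym   = λ p i → sym (p i)
          ; trans = λ p q i → trans (p i) (q i)
          }
        ; reflexive = λ {u} {w} → ≤ʷ-reflexive {u} {w}
        ; trans     = λ p q x → q (p x)
        }
      ; antisym = λ {u} {w} → ≤ʷ-antisym {u} {w}
      }
    ; _≟_  = λ u w → Finₚ.all? (λ i → (u ⟨$⟩ʳ i) Finₚ.≟ (w ⟨$⟩ʳ i))
    ; _≤?_ = _≤ʷ?_
    }

allPerms : ∀ n → List (Permutation′ n)
allPerms zero    = Perm.id ∷ []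
allPerms (suc n) = cartesianProductWith (insert zero) (allFin (suc n)) (allPerms n)

allPerms-complete : ∀ n (w : Permutation′ n) → Any (w Perm.≈_) (allPerms n)
allPerms-complete zero    w = here λ ()
allPerms-complete (suc n) w = cartesianProductWith⁺ (insert zero) (λ {j} {v} → step {j} {v})
  (∈ₚ.∈-allFin (w ⟨$⟩ʳ zero)) (allPerms-complete n (remove zero w))
  where
  insert-cong : ∀ j {u v : Permutation′ n} → u Perm.≈ v → insert zero j u Perm.≈ insert zero j v
  insert-cong j         u≈v zero    = refl
  insert-cong j {u} {v} u≈v (suc k) = trans (Perm.insert-punchIn zero j u k)
    (trans (cong (Fin.punchIn j) (u≈v k)) (sym (Perm.insert-punchIn zero j v k)))
  step : ∀ {j v} → w ⟨$⟩ʳ zero ≡ j → remove zero w Perm.≈ v → w Perm.≈ insert zero j v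
  step {v = v} refl r i = trans (sym (Perm.insert-remove zero w i))
    (insert-cong (w ⟨$⟩ʳ zero) {remove zero w} {v} r i)

weakOrder : ℕ → FinitePoset
weakOrder n = record
  { decPoset = record { isDecPartialOrder = weakIsDecPartialOrder {n} }
  ; elements = allPerms n
  ; complete = allPerms-complete n
  }

[e,_] : ∀ {n} → Permutation′ n → FinitePoset
[e, w ] = interval (weakOrder _) Perm.id w

module _ (X : Setoid 0ℓ 0ℓ) (Φ : Inverse X X) where
  open Setoid X using (Carrier; _≈_)

  private
    Φ^ : ℕ → Carrier → Carrier
    Φ^ k x = ℕ-Iterate.iterate (Inverse.to Φ) x k

  -- k is the least positive integer with Φᵏ x = x, so that
  -- x , Φ x , … , Φᵏ⁻¹ x lists the orbit of x without repetition.
  IsOrbitSize : Carrier → ℕ → Set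
  IsOrbitSize x k = 0 < k × Φ^ k x ≈ x × (∀ m → 0 < m → m < k → ¬ (Φ^ m x ≈ x))

  average : (Carrier → ℚ) → Carrier → (k : ℕ) .{{_ : NonZero k}} → ℚ
  average f x k = foldr ℚ._+_ 0ℚ (map f (iterate (Inverse.to Φ) x k)) ℚ.* (1ℤ ℚ./ k)

  Mesic : (Carrier → ℚ) → ℚ → Set
  Mesic f c = ∀ x k .{{_ : NonZero k}} → IsOrbitSize x k → average f x k ≡ c

-- Boxes are indexed from 0: the box in row i and column j in the usual
-- indexing is (i - 1 , j - 1).  All diagrams needed lie in the positive
-- quadrant.

Box : Set
Box = ℕ × ℕ

Diagram : Set₁
Diagram = Pred Box 0ℓ

record Partition : Set where
  field
    parts      : List ℕ
    decreasing : Linked _≥_ parts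
    positive   : All (0 <_) parts

part : List ℕ → ℕ → ℕ
part []       _       = 0
part (x ∷ _)  zero    = x
part (_ ∷ xs) (suc i) = part xs i

Young : Partition → Diagram
Young μ (i , j) = j < part (Partition.parts μ) i

record SkewShape : Set where
  field
    outer inner : Partition
    inner≤outer : ∀ i → part (Partition.parts inner) i ≤ part (Partition.parts outer) i

  diagram : Diagram
  diagram = Young outer ∖ Young inner

  diagram? : Decidable diagram
  diagram? (i , j) = (j ℕ.<? part (Partition.parts outer) i) ×-dec
                     ¬? (j ℕ.<? part (Partition.parts inner) i)

boxPoset : Diagram → Poset 0ℓ 0ℓ 0ℓ
boxPoset σ = On.poset (×-poset ℕₚ.≤-poset ℕₚ.≤-poset) (proj₁ {B = λ b → b ∈ σ})

Connected : Diagram → Set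
Connected σ = Satisfiable σ × (∀ x y → EqClosure (Order._⋖_ (boxPoset σ)) x y)

-- The a × b rectangle whose northwest corner box is (r , c).
Rectangle : (r c a b : ℕ) → Diagram
Rectangle r c a b (i , j) = (r ≤ i × i < r + a) × (c ≤ j × j < c + b)

IsBoundingBox : Diagram → (r c a b : ℕ) → Set
IsBoundingBox σ r c a b = σ ⊆ Rectangle r c a b ×
  (∀ r′ c′ a′ b′ → σ ⊆ Rectangle r′ c′ a′ b′ → a ≤ a′ × b ≤ b′)

HasHeightAndWidth : Diagram → ℕ → ℕ → Set
HasHeightAndWidth σ a b = ∃₂ λ r c → IsBoundingBox σ r c a b

-- The lattice point at the southeast corner of box (i , j) is an outward corner.
OutwardCorner : SkewShape → ℕ → ℕ → Set
OutwardCorner σ i j =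
  length (filter (SkewShape.diagram? σ)
    ((i , j) ∷ (i , suc j) ∷ (suc i , j) ∷ (suc i , suc j) ∷ [])) ≡ 3

-- Relative to the northwest corner of the bounding rectangle, the southeast
-- corner of box (r + p , c + q) is the point (p + 1 , q + 1), and the main
-- antidiagonal is the set of points (s , t) with s b + t a = a b.
Balanced : SkewShape → Set
Balanced σ = Connected diagram ×
  (∀ r c a b → IsBoundingBox diagram r c a b →
   ∀ p q → OutwardCorner σ (r + p) (c + q) → suc p * b + suc q * a ≡ a * b)
  where open SkewShape σ

height+width≢0 : ∀ (σ : SkewShape) {a b} → HasHeightAndWidth (SkewShape.diagram σ) a b →
                 Balanced σ → NonZero (a + b)
height+width≢0 _ {a = zero} (r , c , inside , _) ((((i , j) , ij∈σ) , _) , _) with inside ij∈σ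
... | (r≤i , i<r+0) , _ =
  ⊥-elim (ℕₚ.<⇒≱ i<r+0 (subst (_≤ i) (sym (ℕₚ.+-identityʳ r)) r≤i))
height+width≢0 _ {a = suc _} _ _ = _

Rothe : ∀ {n} → Permutation′ n → Diagram
Rothe w (r , c) = ∃₂ λ i j → (i , j) ∈ Inv w × r ≡ toℕ i × c ≡ toℕ (w ⟨$⟩ʳ j)

SkewVexillary : ∀ {n} → Permutation′ n → SkewShape → Set
SkewVexillary w σ = ∃₂ λ (ρ κ : ℕ ↔ ℕ) → ∀ r c →
  ((r , c) ∈ Rothe w) ⇔ ((Inverse.to ρ r , Inverse.to κ c) ∈ SkewShape.diagram σ)

{-# OPTIONS --safe #-}

-- Let Δ x y mean that x < y and that y precedes x in the word of w.  The elements of [e, w] are the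
-- words in which x precedes y whenever x < y and not Δ x y, and its covers exchange adjacent letters.
--
-- The label of u ⋖ z is the least t ≤ z that inverts the exchanged pair, and this pair is the only
-- descent of t.  Hence row matches the ascents of u lying in Δ with the descents of row u, and a weight
-- of exchanges that depends only on the label telescopes along an orbit.  It remains to find a weight
-- with (a + b) ddeg = ab + (weights of the descents) − (weights of the ascents).
--
-- Divide the main antidiagonal of the a × b rectangle into ab equal steps τ.  Each step meets one box;
-- let X be the letter of its column and Y that of its row.  As no outward corner lies off the
-- antidiagonal, Δ X Y holds, and Δ l Y and Δ X r imply Δ l r.  Call l low if Δ l Y and r high if Δ X r.
-- All letters from X to Y in a word of [e, w] are low or high and not both, so on the way from X to Y
-- there is one more step from low to high than from high to low.  The weight of an exchange of l and r
-- is the sum over the τ with l low and r high of ±1 if the gap between them lies between X and Y, with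
-- the sign of the direction.  The numbers one add up to ab, and since each column belongs to a steps
-- and each row to b steps, reading the gap of a descent with the letters exchanged costs a + b.

module Submission where

open import Defs
open import Data.Empty using (⊥; ⊥-elim)
open import Data.Fin as Fin using (Fin; zero; suc; toℕ)
open import Data.Fin.Permutation as Perm
  using (Permutation′; _⟨$⟩ʳ_; _⟨$⟩ˡ_; _∘ₚ_; inverseˡ; inverseʳ)
import Data.Fin.Permutation.Components as PC
import Data.Fin.Properties as Finₚ
open import Data.Integer as ℤ using (ℤ; +_; 0ℤ; 1ℤ)
import Data.Integer.Properties as ℤₚ
open import Data.Integer.Tactic.RingSolver using (solve-∀)
open import Data.List using (List; []; _∷_; _++_; length; filter; map; foldr; iterate; lookup;
  tabulate; allFin; deduplicate; cartesianProduct)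
open import Data.List.Membership.Propositional.Properties
  using (∈-lookup; ∈-filter⁻; ∈-filter⁺; ∈-cartesianProduct⁺; ∈-allFin)
import Data.List.Membership.Setoid.Properties as Memₛ
import Data.List.Properties as Listₚ
open import Data.List.Relation.Unary.All as All using (_∷_)
open import Data.List.Relation.Unary.AllPairs using (_∷_)
open import Data.List.Relation.Unary.Any as Any using (Any; here; there)
open import Data.List.Relation.Unary.Any.Properties using (lookup-index)
open import Data.List.Relation.Unary.Linked using (Linked; _∷_)
import Data.List.Relation.Unary.Unique.DecSetoid.Properties as UniqueDecₚ
import Data.List.Relation.Unary.Unique.Propositional.Properties as Uniqueₚ
import Data.List.Relation.Unary.Unique.Setoid as Uniqueₛ
open import Data.Nat as ℕ using (ℕ; zero; suc; _+_; _*_; _∸_; _≤_; _<_; _≥_; z≤n; s≤s; NonZero)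
import Data.Nat.GeneralisedArithmetic as ℕ-Iterate
import Data.Nat.Properties as ℕₚ
open import Data.Product using (Σ; ∃; ∃₂; _×_; _,_; proj₁; proj₂)
open import Data.Rational as ℚ using (0ℚ; _/_)
import Data.Rational.Properties as ℚₚ
open import Data.Rational.Unnormalised as ℚᵘ using (mkℚᵘ; *≡*)
import Data.Rational.Unnormalised.Properties as ℚᵘₚ
open import Data.Sum using (_⊎_; inj₁; inj₂)
open import Function using (_∘_; Equivalence; Injection; Inverse)
open import Function.Properties.Inverse using (↔⇒↣)
open import Level using (0ℓ)
open import Relation.Binary
  using (IsDecPartialOrder; IsEquivalence; Poset; Setoid; _Respects_; tri<; tri≈; tri>)
open import Relation.Binary.Construct.Closure.Equivalence using (fold)
open import Relation.Binary.PropositionalEquality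
  using (_≡_; _≢_; refl; sym; trans; cong; cong₂; subst; subst₂; setoid; module ≡-Reasoning)
open import Relation.Nullary using (¬_; Dec; yes; no; contradiction)
open import Relation.Nullary.Decidable using (_×-dec_)
open import Relation.Unary using (Decidable; _∈_; _≐_)
open import Algebra.Properties.Semiring.Sum ℤₚ.+-*-semiring
  using (sum; sum-syntax; sum-cong-≗; ∑-distrib-+; ∑-comm; sum-permute; sum-replicate-zero;
         *-distribˡ-sum)

-- Sums of indicators

⟦_⟧ : {P : Set} → Dec P → ℤ
⟦ yes _ ⟧ = 1ℤ
⟦ no  _ ⟧ = 0ℤ

⟦⟧-yes : {P : Set} (d : Dec P) → P → ⟦ d ⟧ ≡ 1ℤ
⟦⟧-yes (yes _) _ = refl
⟦⟧-yes (no ¬p) p = ⊥-elim (¬p p)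

⟦⟧-no : {P : Set} (d : Dec P) → ¬ P → ⟦ d ⟧ ≡ 0ℤ
⟦⟧-no (yes p) ¬p = ⊥-elim (¬p p)
⟦⟧-no (no _)  _  = refl

⟦⟧-cong : {P Q : Set} (d : Dec P) (d′ : Dec Q) → (P → Q) → (Q → P) → ⟦ d ⟧ ≡ ⟦ d′ ⟧
⟦⟧-cong d (yes q) f g = ⟦⟧-yes d (g q)
⟦⟧-cong d (no ¬q) f g = ⟦⟧-no d (¬q ∘ f)

∑-const : ∀ n c → ∑[ i < n ] c ≡ + n ℤ.* c
∑-const zero    c = sym (ℤₚ.*-zeroˡ c)
∑-const (suc n) c = trans (cong (λ z → c ℤ.+ z) (∑-const n c)) (sym (ℤₚ.suc-* (+ n) c))

∑-neg : ∀ {n} (f : Fin n → ℤ) → ∑[ i < n ] (ℤ.- f i) ≡ ℤ.- sum f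
∑-neg {zero}  f = refl
∑-neg {suc n} f = trans (cong (λ z → ℤ.- f zero ℤ.+ z) (∑-neg (f ∘ suc)))
                        (sym (ℤₚ.neg-distrib-+ (f zero) _))

∑-distrib-- : ∀ {n} (f g : Fin n → ℤ) → ∑[ i < n ] (f i ℤ.- g i) ≡ sum f ℤ.- sum g
∑-distrib-- f g = trans (∑-distrib-+ f (ℤ.-_ ∘ g)) (cong (λ z → sum f ℤ.+ z) (∑-neg g))

∑-single : ∀ {n} (f : Fin n → ℤ) k → (∀ i → i ≢ k → f i ≡ 0ℤ) → sum f ≡ f k
∑-single {suc n} f zero    h =
  trans (cong (λ z → f zero ℤ.+ z) (trans (sum-cong-≗ (λ i → h (suc i) λ ())) (sum-replicate-zero n)))
        (ℤₚ.+-identityʳ _)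
∑-single {suc n} f (suc k) h =
  trans (cong₂ ℤ._+_ (h zero λ ()) (∑-single (f ∘ suc) k (λ i i≢k → h (suc i) (i≢k ∘ Finₚ.suc-injective))))
        (ℤₚ.+-identityˡ _)

infix 4 _⋯_ _⋯?_

_⋯_ : ∀ {n} → Fin n → Fin n → Set
i ⋯ j = toℕ j ≡ suc (toℕ i)

_⋯?_ : ∀ {n} (i j : Fin n) → Dec (i ⋯ j)
i ⋯? j = toℕ j ℕ.≟ suc (toℕ i)

⋯-ind : ∀ {n} (R : Fin n → Fin n → Set) → (∀ {i j k} → R i j → R j k → R i k) →
        (∀ {i j} → i ⋯ j → R i j) → ∀ {i j} → i Fin.< j → R i j
⋯-ind {suc n} R tr step {zero}  {suc zero} _ = step refl
⋯-ind {suc (suc n)} R tr step {zero}  {suc (suc j)} _ =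
  tr (step {zero} {suc zero} refl)
     (⋯-ind (λ i k → R (suc i) (suc k)) tr (λ e → step (cong suc e)) {zero} {suc j} (s≤s z≤n))
⋯-ind {suc n} R tr step {suc i} {suc j} (s≤s i<j) =
  ⋯-ind (λ i k → R (suc i) (suc k)) tr (λ e → step (cong suc e)) i<j

telescope-alg : ∀ x y z → 1ℤ ℤ.* (1ℤ ℤ.* (y ℤ.- x)) ℤ.+ (z ℤ.- y) ≡ z ℤ.- x
telescope-alg = solve-∀

-- Consecutive pairs are selected by an indicator inside a double sum, so that both indices can
-- later be permuted from positions to letters.
telescope : ∀ {n} (g : Fin (suc n) → ℤ) (m : Fin (suc n)) →
  ∑[ i < suc n ] ∑[ j < suc n ] (⟦ i ⋯? j ⟧ ℤ.* (⟦ m Finₚ.≤? i ⟧ ℤ.* (g j ℤ.- g i)))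
    ≡ g (Fin.fromℕ n) ℤ.- g m
telescope {zero} g zero = sym (ℤₚ.+-inverseʳ (g zero))
telescope {suc n} g m = begin
  ∑[ i < 2 ℕ.+ n ] ∑[ j < 2 ℕ.+ n ] F m i j
    ≡⟨ cong₂ ℤ._+_ (∑-single (F m zero) (suc zero) first) (sum-cong-≗ {suc n} rest) ⟩
  F m zero (suc zero) ℤ.+ ∑[ i < suc n ] ∑[ j < suc n ] F m (suc i) (suc j)
    ≡⟨ byCases m ⟩
  g (Fin.fromℕ (suc n)) ℤ.- g m ∎
  where
  open ≡-Reasoning
  F : Fin (2 ℕ.+ n) → Fin (2 ℕ.+ n) → Fin (2 ℕ.+ n) → ℤ
  F m i j = ⟦ i ⋯? j ⟧ ℤ.* (⟦ m Finₚ.≤? i ⟧ ℤ.* (g j ℤ.- g i))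
  first : ∀ j → j ≢ suc zero → F m zero j ≡ 0ℤ
  first j j≢1 = cong (ℤ._* (⟦ m Finₚ.≤? zero {n = suc n} ⟧ ℤ.* (g j ℤ.- g zero)))
    (⟦⟧-no (zero {n = suc n} ⋯? j) (λ e → j≢1 (Finₚ.toℕ-injective e)))
  rest : ∀ i → ∑[ j < 2 ℕ.+ n ] F m (suc i) j ≡ ∑[ j < suc n ] F m (suc i) (suc j)
  rest i = trans (cong (λ z → z ℤ.+ ∑[ j < suc n ] F m (suc i) (suc j))
    (cong (ℤ._* (⟦ m Finₚ.≤? suc i ⟧ ℤ.* (g zero ℤ.- g (suc i)))) (⟦⟧-no (suc i ⋯? zero) λ ())))
    (ℤₚ.+-identityˡ _)
  inner : ∀ m m′ → (∀ i → ⟦ m Finₚ.≤? suc i ⟧ ≡ ⟦ m′ Finₚ.≤? i ⟧) →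
    ∑[ i < suc n ] ∑[ j < suc n ] F m (suc i) (suc j) ≡ g (Fin.fromℕ (suc n)) ℤ.- g (suc m′)
  inner m m′ eq = trans
    (sum-cong-≗ {suc n} λ i → sum-cong-≗ {suc n} λ j → cong₂ ℤ._*_
      (⟦⟧-cong (suc i ⋯? suc j) (i ⋯? j) ℕₚ.suc-injective (cong suc))
      (cong (ℤ._* (g (suc j) ℤ.- g (suc i))) (eq i)))
    (telescope (g ∘ suc) m′)
  byCases : ∀ m → F m zero (suc zero) ℤ.+ ∑[ i < suc n ] ∑[ j < suc n ] F m (suc i) (suc j)
    ≡ g (Fin.fromℕ (suc n)) ℤ.- g m
  byCases zero    = trans (cong (λ z → F zero zero (suc zero) ℤ.+ z) (inner zero zero (λ _ → refl)))
    (telescope-alg (g zero) (g (suc zero)) (g (Fin.fromℕ (suc n))))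
  byCases (suc m) = trans (ℤₚ.+-identityˡ _)
    (inner (suc m) m (λ i → ⟦⟧-cong (suc m Finₚ.≤? suc i) (m Finₚ.≤? i) ℕ.s≤s⁻¹ s≤s))

∑-↑ : ∀ m {n} (f : Fin (m ℕ.+ n) → ℤ) →
      sum f ≡ ∑[ i < m ] f (i Fin.↑ˡ n) ℤ.+ ∑[ j < n ] f (m Fin.↑ʳ j)
∑-↑ zero    f = sym (ℤₚ.+-identityˡ _)
∑-↑ (suc m) f = trans (cong (λ z → f zero ℤ.+ z) (∑-↑ m (f ∘ suc))) (sym (ℤₚ.+-assoc (f zero) _ _))

∑-combine : ∀ m {n} (f : Fin (m ℕ.* n) → ℤ) →
            sum f ≡ ∑[ i < m ] ∑[ j < n ] f (Fin.combine i j)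
∑-combine zero    f = refl
∑-combine (suc m) {n} f = trans (∑-↑ n f)
  (cong (λ z → ∑[ j < n ] f (j Fin.↑ˡ (m ℕ.* n)) ℤ.+ z) (∑-combine m (λ k → f (n Fin.↑ʳ k))))

-- The indices with quotient `i` are exactly the `n` indices `combine i j`.
∑-quotient : ∀ {m} n (i : Fin m) → ∑[ k < m ℕ.* n ] ⟦ Fin.quotient {m} n k Finₚ.≟ i ⟧ ≡ + n
∑-quotient {m} n i = begin
  ∑[ k < m ℕ.* n ] ⟦ Fin.quotient n k Finₚ.≟ i ⟧
    ≡⟨ ∑-combine m (λ k → ⟦ Fin.quotient n k Finₚ.≟ i ⟧) ⟩
  ∑[ i′ < m ] ∑[ j < n ] ⟦ Fin.quotient n (Fin.combine i′ j) Finₚ.≟ i ⟧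
    ≡⟨ sum-cong-≗ {m} (λ i′ → trans (sum-cong-≗ {n} (λ j →
         cong (λ p → ⟦ proj₁ p Finₚ.≟ i ⟧) (Finₚ.remQuot-combine i′ j))) (∑-const n _)) ⟩
  ∑[ i′ < m ] (+ n ℤ.* ⟦ i′ Finₚ.≟ i ⟧)
    ≡⟨ ∑-single (λ i′ → + n ℤ.* ⟦ i′ Finₚ.≟ i ⟧) i (λ i′ i′≢i →
         trans (cong (λ z → + n ℤ.* z) (⟦⟧-no (i′ Finₚ.≟ i) i′≢i)) (ℤₚ.*-zeroʳ (+ n))) ⟩
  + n ℤ.* ⟦ i Finₚ.≟ i ⟧
    ≡⟨ trans (cong (λ z → + n ℤ.* z) (⟦⟧-yes (i Finₚ.≟ i) refl)) (ℤₚ.*-identityʳ (+ n)) ⟩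
  + n ∎
  where open ≡-Reasoning

-- Adjacent exchanges and covers in the weak order

module _ {n : ℕ} where

  -- A permutation is read as the word of its values. Its inverse gives the place of a letter, so
  -- `Inv⁻¹` consists of the pairs of letters that stand out of order.
  pos : Permutation′ n → Fin n → Fin n
  pos u v = u ⟨$⟩ˡ v

  pos-injective : ∀ u {x y} → pos u x ≡ pos u y → x ≡ y
  pos-injective u e = trans (sym (inverseʳ u)) (trans (cong (u ⟨$⟩ʳ_) e) (inverseʳ u))

  pos-cong : ∀ {u v : Permutation′ n} → u Perm.≈ v → ∀ z → pos u z ≡ pos v z
  pos-cong {u} {v} u≈v z =
    trans (sym (inverseˡ v)) (cong (v ⟨$⟩ˡ_) (trans (sym (u≈v (pos u z))) (inverseʳ u)))

  Before : Permutation′ n → Fin n → Fin n → Set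
  Before u x y = pos u x Fin.< pos u y

  before-total : ∀ u {x y} → x ≢ y → Before u x y ⊎ Before u y x
  before-total u {x} {y} x≢y with Finₚ.<-cmp (pos u x) (pos u y)
  ... | tri< p _ _ = inj₁ p
  ... | tri≈ _ p _ = contradiction (pos-injective u p) x≢y
  ... | tri> _ _ p = inj₂ p

  inv⁻¹? : ∀ u x y → Dec (Inv⁻¹ u (x , y))
  inv⁻¹? u x y = (x Finₚ.<? y) ×-dec (pos u y Finₚ.<? pos u x)

  before-mono : ∀ {u v : Permutation′ n} → u ≤ʷ v → ∀ {x y} → x Fin.< y → Before v x y → Before u x y
  before-mono {u} {v} u≤v {x} {y} x<y p with before-total u (Finₚ.<⇒≢ x<y)
  ... | inj₁ q = q
  ... | inj₂ q = contradiction (proj₂ (u≤v {x , y} (x<y , q))) (ℕₚ.<-asym p)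

  -- Both are indexed by letters with the smaller one first, so an exchange turns an ascent into a
  -- descent of the same pair.
  Asc Desc : Permutation′ n → Fin n → Fin n → Set
  Asc  u x y = x Fin.< y × pos u x ⋯ pos u y
  Desc u x y = x Fin.< y × pos u y ⋯ pos u x

  ⋯⇒< : {i j : Fin n} → i ⋯ j → i Fin.< j
  ⋯⇒< e = ℕₚ.≤-reflexive (sym e)

  Desc⇒Inv⁻¹ : ∀ u {x y} → Desc u x y → Inv⁻¹ u (x , y)
  Desc⇒Inv⁻¹ u (x<y , e) = x<y , ⋯⇒< e

  Asc⇒¬Inv⁻¹ : ∀ u {x y} → Asc u x y → ¬ Inv⁻¹ u (x , y)
  Asc⇒¬Inv⁻¹ u (_ , e) (_ , q) = ℕₚ.<-asym (⋯⇒< e) q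

  -- Otherwise the letters of t would be increasing in position in s.
  descent-exists : ∀ {s t : Permutation′ n} → s ≤ʷ t → ¬ (t ≤ʷ s) →
                   ∃₂ λ x y → Desc t x y × ¬ Inv⁻¹ s (x , y)
  descent-exists {s} {t} s≤t t≰s
    with Finₚ.any? (λ x → Finₚ.any? λ y →
           ((x Finₚ.<? y) ×-dec (pos t y ⋯? pos t x)) ×-dec (pos s x Finₚ.<? pos s y))
  ... | yes (x , y , d , p) = x , y , d , λ (_ , q) → ℕₚ.<-asym p q
  ... | no none = contradiction (λ {p} → t≤s p) t≰s
    where
    step : ∀ {i j} → i ⋯ j → Before s (t ⟨$⟩ʳ i) (t ⟨$⟩ʳ j)
    step {i} {j} e with Finₚ.<-cmp (t ⟨$⟩ʳ i) (t ⟨$⟩ʳ j)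
    ... | tri< p _ _ = before-mono {s} {t} s≤t p
            (subst₂ Fin._<_ (sym (inverseˡ t)) (sym (inverseˡ t)) (⋯⇒< e))
    ... | tri≈ _ p _ = contradiction
            (trans (sym (inverseˡ t)) (trans (cong (t ⟨$⟩ˡ_) p) (inverseˡ t))) (Finₚ.<⇒≢ (⋯⇒< e))
    ... | tri> _ t≢ p with before-total s t≢
    ...   | inj₁ q = q
    ...   | inj₂ q = contradiction
            (_ , _ , (p , subst₂ _⋯_ (sym (inverseˡ t)) (sym (inverseˡ t)) e) , q) none
    increasing : ∀ {i j} → i Fin.< j → Before s (t ⟨$⟩ʳ i) (t ⟨$⟩ʳ j)
    increasing = ⋯-ind (λ i j → Before s (t ⟨$⟩ʳ i) (t ⟨$⟩ʳ j)) ℕₚ.<-trans step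
    t≤s : ∀ p → Inv⁻¹ t p → Inv⁻¹ s p
    t≤s (x , y) (x<y , q) = x<y , subst₂ (Before s) (inverseʳ t) (inverseʳ t) (increasing q)

  -- `_∘ₚ_` applies its left argument first, so the transposition acts on letters and not on
  -- positions.
  swap : Permutation′ n → Fin n → Fin n → Permutation′ n
  swap u x y = u ∘ₚ Perm.transpose x y

  transpose-fix : ∀ {x y z : Fin n} → z ≢ x → z ≢ y → PC.transpose x y z ≡ z
  transpose-fix {x} {y} {z} z≢x z≢y with z Finₚ.≟ x
  ... | yes z≡x = contradiction z≡x z≢x
  ... | no  _ with z Finₚ.≟ y
  ...   | yes z≡y = contradiction z≡y z≢y
  ...   | no  _ = refl

  transposeˡ : ∀ (x y : Fin n) → PC.transpose x y x ≡ y
  transposeˡ x y with x Finₚ.≟ x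
  ... | yes _   = refl
  ... | no  x≢x = contradiction refl x≢x

  transposeʳ : ∀ (x y : Fin n) → PC.transpose x y y ≡ x
  transposeʳ x y with y Finₚ.≟ x
  ... | yes y≡x = y≡x
  ... | no  _ with y Finₚ.≟ y
  ...   | yes _   = refl
  ...   | no  y≢y = contradiction refl y≢y

  pos-swapˡ : ∀ u x y → pos (swap u x y) x ≡ pos u y
  pos-swapˡ u x y = cong (pos u) (transposeʳ y x)

  pos-swapʳ : ∀ u x y → pos (swap u x y) y ≡ pos u x
  pos-swapʳ u x y = cong (pos u) (transposeˡ y x)

  pos-swap-fix : ∀ u {x y z} → z ≢ x → z ≢ y → pos (swap u x y) z ≡ pos u z
  pos-swap-fix u z≢x z≢y = cong (pos u) (transpose-fix z≢y z≢x)

  Adj : Permutation′ n → Fin n → Fin n → Set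
  Adj u x y = pos u x ⋯ pos u y ⊎ pos u y ⋯ pos u x

  -- Nothing fits between adjacent positions, so a third letter stands on the same side of both.
  adj-beforeˡ : ∀ u {x y z} → Adj u x y → z ≢ x → z ≢ y → Before u z x → Before u z y
  adj-beforeˡ u (inj₁ e) _ _ p = ℕₚ.<-trans p (⋯⇒< e)
  adj-beforeˡ u {z = z} (inj₂ e) z≢x z≢y p =
    ℕₚ.≤∧≢⇒< (ℕ.s≤s⁻¹ (subst (suc (toℕ (pos u z)) ≤_) e p))
             (z≢y ∘ pos-injective u ∘ Finₚ.toℕ-injective)

  adj-beforeʳ : ∀ u {x y z} → Adj u x y → z ≢ x → z ≢ y → Before u x z → Before u y z
  adj-beforeʳ u (inj₂ e) _ _ p = ℕₚ.<-trans (⋯⇒< e) p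
  adj-beforeʳ u {z = z} (inj₁ e) z≢x z≢y p =
    ℕₚ.≤∧≢⇒< (subst (_≤ toℕ (pos u z)) (sym e) p)
             (z≢y ∘ sym ∘ pos-injective u ∘ Finₚ.toℕ-injective)

  adj-sym : ∀ u {x y} → Adj u x y → Adj u y x
  adj-sym u (inj₁ e) = inj₂ e
  adj-sym u (inj₂ e) = inj₁ e

  swap-before : ∀ u {x y} → Adj u x y → ∀ {c d} → c ≢ d → ¬ (c ≡ x × d ≡ y) → ¬ (c ≡ y × d ≡ x) →
                Before u c d → Before (swap u x y) c d
  swap-before u {x} {y} a {c} {d} c≢d nxy nyx p = go (c Finₚ.≟ x) (c Finₚ.≟ y) (d Finₚ.≟ x) (d Finₚ.≟ y)
    where
    go : Dec (c ≡ x) → Dec (c ≡ y) → Dec (d ≡ x) → Dec (d ≡ y) → Before (swap u x y) c d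
    go (yes refl) _ (yes refl) _ = contradiction refl c≢d
    go (yes refl) _ (no _) (yes refl) = contradiction (refl , refl) nxy
    go (yes refl) _ (no d≢x) (no d≢y) =
      subst₂ Fin._<_ (sym (pos-swapˡ u x y)) (sym (pos-swap-fix u d≢x d≢y)) (adj-beforeʳ u a d≢x d≢y p)
    go (no _) (yes refl) (yes refl) _ = contradiction (refl , refl) nyx
    go (no _) (yes refl) (no _) (yes refl) = contradiction refl c≢d
    go (no _) (yes refl) (no d≢x) (no d≢y) =
      subst₂ Fin._<_ (sym (pos-swapʳ u x y)) (sym (pos-swap-fix u d≢x d≢y))
        (adj-beforeʳ u (adj-sym u a) d≢y d≢x p)
    go (no c≢x) (no c≢y) (yes refl) _ =
      subst₂ Fin._<_ (sym (pos-swap-fix u c≢x c≢y)) (sym (pos-swapˡ u x y)) (adj-beforeˡ u a c≢x c≢y p)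
    go (no c≢x) (no c≢y) (no _) (yes refl) =
      subst₂ Fin._<_ (sym (pos-swap-fix u c≢x c≢y)) (sym (pos-swapʳ u x y))
        (adj-beforeˡ u (adj-sym u a) c≢y c≢x p)
    go (no c≢x) (no c≢y) (no d≢x) (no d≢y) =
      subst₂ Fin._<_ (sym (pos-swap-fix u c≢x c≢y)) (sym (pos-swap-fix u d≢x d≢y)) p

  swap-before⁻ : ∀ u {x y} → Adj u x y → ∀ {c d} → c ≢ d → ¬ (c ≡ x × d ≡ y) → ¬ (c ≡ y × d ≡ x) →
                 Before (swap u x y) c d → Before u c d
  swap-before⁻ u a c≢d nxy nyx p with before-total u c≢d
  ... | inj₁ q = q
  ... | inj₂ q = contradiction p (ℕₚ.<-asym
    (swap-before u a (c≢d ∘ sym) (λ (e , f) → nyx (f , e)) (λ (e , f) → nxy (f , e)) q))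

  -- An exchange is recorded by its effect on inversions and not as an equation between
  -- permutations, since elements of the order are compared only pointwise.
  record Step (u z : Permutation′ n) (x y : Fin n) : Set where
    field
      below : u ≤ʷ z
      asc   : Asc u x y
      desc  : Desc z x y
      only  : ∀ {c d} → Inv⁻¹ z (c , d) → Inv⁻¹ u (c , d) ⊎ (c ≡ x × d ≡ y)

  private
    pair? : ∀ (c d x y : Fin n) → Dec (c ≡ x × d ≡ y)
    pair? c d x y = (c Finₚ.≟ x) ×-dec (d Finₚ.≟ y)

    reversed : ∀ {x y c d : Fin n} → x Fin.< y → c Fin.< d → ¬ (c ≡ y × d ≡ x)
    reversed x<y c<d (refl , refl) = ℕₚ.<-asym x<y c<d

  step-up : ∀ {u : Permutation′ n} {x y} → Asc u x y → Step u (swap u x y) x y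
  step-up {u} {x} {y} (x<y , e) = record
    { below = λ {p} → below p
    ; asc   = x<y , e
    ; desc  = x<y , subst₂ _⋯_ (sym (pos-swapʳ u x y)) (sym (pos-swapˡ u x y)) e
    ; only  = only
    }
    where
    below : ∀ p → Inv⁻¹ u p → Inv⁻¹ (swap u x y) p
    below (c , d) (c<d , q) = c<d , swap-before u (inj₁ e) (Finₚ.<⇒≢ c<d ∘ sym)
      (λ (d≡x , c≡y) → reversed x<y c<d (c≡y , d≡x))
      (λ { (refl , refl) → ℕₚ.<-asym q (⋯⇒< e) }) q
    only : ∀ {c d} → Inv⁻¹ (swap u x y) (c , d) → Inv⁻¹ u (c , d) ⊎ (c ≡ x × d ≡ y)
    only {c} {d} (c<d , q) with pair? c d x y
    ... | yes r = inj₂ r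
    ... | no ¬r = inj₁ (c<d , swap-before⁻ u (inj₁ e) (Finₚ.<⇒≢ c<d ∘ sym)
      (λ (d≡x , c≡y) → reversed x<y c<d (c≡y , d≡x)) (λ (d≡y , c≡x) → ¬r (c≡x , d≡y)) q)

  step-down : ∀ {z : Permutation′ n} {x y} → Desc z x y → Step (swap z x y) z x y
  step-down {z} {x} {y} (x<y , e) = record
    { below = λ {p} → below p
    ; asc   = x<y , subst₂ _⋯_ (sym (pos-swapˡ z x y)) (sym (pos-swapʳ z x y)) e
    ; desc  = x<y , e
    ; only  = only
    }
    where
    below : ∀ p → Inv⁻¹ (swap z x y) p → Inv⁻¹ z p
    below (c , d) (c<d , q) = c<d , swap-before⁻ z (inj₂ e) (Finₚ.<⇒≢ c<d ∘ sym)
      (λ (d≡x , c≡y) → reversed x<y c<d (c≡y , d≡x))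
      (λ { (refl , refl) → ℕₚ.<-asym q
             (subst₂ Fin._<_ (sym (pos-swapˡ z x y)) (sym (pos-swapʳ z x y)) (⋯⇒< e)) }) q
    only : ∀ {c d} → Inv⁻¹ z (c , d) → Inv⁻¹ (swap z x y) (c , d) ⊎ (c ≡ x × d ≡ y)
    only {c} {d} (c<d , q) with pair? c d x y
    ... | yes r = inj₂ r
    ... | no ¬r = inj₁ (c<d , swap-before z (inj₂ e) (Finₚ.<⇒≢ c<d ∘ sym)
      (λ (d≡x , c≡y) → reversed x<y c<d (c≡y , d≡x)) (λ (d≡y , c≡x) → ¬r (c≡x , d≡y)) q)

  step-congˡ : ∀ {s u z : Permutation′ n} {x y} → u Perm.≈ s → Step s z x y → Step u z x y
  step-congˡ {s} {u} {z} {x} {y} u≈s st = record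
    { below = λ { {c , d} (c<d , q) → Step.below st {c , d} (c<d , subst₂ Fin._<_ (pos≡ d) (pos≡ c) q) }
    ; asc   = proj₁ (Step.asc st) , subst₂ _⋯_ (sym (pos≡ x)) (sym (pos≡ y)) (proj₂ (Step.asc st))
    ; desc  = Step.desc st
    ; only  = λ {c} {d} q → back (Step.only st q)
    }
    where
    pos≡ : ∀ v → pos u v ≡ pos s v
    pos≡ = pos-cong {u} {s} u≈s
    back : ∀ {c d} → Inv⁻¹ s (c , d) ⊎ (c ≡ x × d ≡ y) → Inv⁻¹ u (c , d) ⊎ (c ≡ x × d ≡ y)
    back {c} {d} (inj₁ (c<d , q)) = inj₁ (c<d , subst₂ Fin._<_ (sym (pos≡ d)) (sym (pos≡ c)) q)
    back (inj₂ r) = inj₂ r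

  antisym : {u v : Permutation′ n} → u ≤ʷ v → v ≤ʷ u → u Perm.≈ v
  antisym {u} {v} = IsDecPartialOrder.antisym weakIsDecPartialOrder {u} {v}

  ≈⇒≤ : {u v : Permutation′ n} → u Perm.≈ v → u ≤ʷ v
  ≈⇒≤ {u} {v} = IsDecPartialOrder.reflexive weakIsDecPartialOrder {u} {v}

  id-least : (u : Permutation′ n) → Perm.id ≤ʷ u
  id-least u (x<y , y<x) = contradiction y<x (ℕₚ.<-asym x<y)

  module _ (w : Permutation′ n) where
    open FinitePoset [e, w ] using (Carrier; poset)
    open FinitePoset (weakOrder n) using () renaming (_≟_ to _≟ₚ_; module Eq to Eqₚ)
    open Order poset using (_⋖_)

    member : ∀ (u : Permutation′ n) → u ≤ʷ w → Carrier
    member u u≤w = u , (λ {p} → id-least u {p}) , λ {p} → u≤w {p}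

    -- The inversions of an element in between are those of `u`, with or without the pair `(x , y)`.
    -- This leaves only `u` and `z`.
    step⇒cover : (u z : Carrier) → ∀ {x y} → Step (proj₁ u) (proj₁ z) x y → u ⋖ z
    step⇒cover (u , _) (z , _) {x} {y} st =
      ((λ {p} → below {p}) , λ u≈z → Asc⇒¬Inv⁻¹ u asc (≈⇒≤ {z} {u} (Eqₚ.sym {u} {z} u≈z) {x , y} (Desc⇒Inv⁻¹ z desc))) ,
      λ (t , _) ((u≤t , u≉t) , (t≤z , t≉z)) → between t u≤t u≉t t≤z t≉z
      where
      open Step st
      between : ∀ t → u ≤ʷ t → ¬ (u Perm.≈ t) → t ≤ʷ z → ¬ (t Perm.≈ z) → ⊥
      between t u≤t u≉t t≤z t≉z with inv⁻¹? t x y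
      ... | yes q = t≉z (antisym {t} {z} t≤z λ { {c , d} r → up (only r) })
        where
        up : ∀ {c d} → Inv⁻¹ u (c , d) ⊎ (c ≡ x × d ≡ y) → Inv⁻¹ t (c , d)
        up {c} {d} (inj₁ r) = u≤t {c , d} r
        up (inj₂ (refl , refl)) = q
      ... | no ¬q = u≉t (antisym {u} {t} u≤t λ { {c , d} r → down r (only (t≤z {c , d} r)) })
        where
        down : ∀ {c d} → Inv⁻¹ t (c , d) → Inv⁻¹ u (c , d) ⊎ (c ≡ x × d ≡ y) → Inv⁻¹ u (c , d)
        down r (inj₁ s) = s
        down r (inj₂ (refl , refl)) = contradiction r ¬q

    -- Undoing a descent of `z` that `u` does not invert gives an element `s` with `u ≤ s` and `s`
    -- covered by `z`. As `z` covers `u`, nothing can lie strictly between, so `u ≈ s`.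
    cover⇒step : (u z : Carrier) → u ⋖ z → ∃₂ λ x y → Step (proj₁ u) (proj₁ z) x y
    cover⇒step (u , _ , u≤w) (z , _ , z≤w) ((u≤z , u≉z) , none)
      with descent-exists {u} {z} u≤z (λ z≤u → u≉z (antisym {u} {z} u≤z z≤u))
    ... | x , y , d , ¬q = x , y , step-congˡ {s} {u} {z} u≈s st
      where
      s = swap z x y
      st : Step s z x y
      st = step-down {z} d
      u≤s : u ≤ʷ s
      u≤s {a , b} r with Step.only st (u≤z {a , b} r)
      ... | inj₁ q = q
      ... | inj₂ (refl , refl) = contradiction r ¬q
      s⋖z : member s (λ {p} → z≤w {p} ∘ Step.below st {p}) ⋖ (z , (λ {p} → id-least z {p}) , z≤w)
      s⋖z = step⇒cover (member s (λ {p} → z≤w {p} ∘ Step.below st {p}))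
                       (z , (λ {p} → id-least z {p}) , z≤w) st
      u≈s : u Perm.≈ s
      u≈s with u ≟ₚ s
      ... | yes e = e
      ... | no u≉s = contradiction
        (((λ {p} → u≤s {p}) , u≉s) , proj₁ s⋖z)
        (none (member s (λ {p} → z≤w {p} ∘ Step.below st {p})))

-- Edge labels

module _ (F : FinitePoset) where
  open FinitePoset F
  private module P = Poset poset

  -- A candidate is kept while the list is scanned from its end, and is replaced by any element of
  -- `S` below it. What lies below the new candidate also lies below the old one, so minimality
  -- against the elements already scanned survives.
  below-minimal : {S : Carrier → Set} → Decidable S → S Respects _≈_ → ∀ x → S x →
                  ∃ λ m → m ⊑ x × S m × (∀ t → S t → t ⊑ m → t ≈ m)
  below-minimal {S} S? resp x Sx =
    let m , m⊑x , Sm , min = search elements in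
    m , m⊑x , Sm , λ t → min (complete t)
    where
    search : (es : List Carrier) → ∃ λ m → m ⊑ x × S m × (∀ {t} → Any (t ≈_) es → S t → t ⊑ m → t ≈ m)
    search [] = x , P.refl , Sx , λ ()
    search (e ∷ es) with search es
    ... | m , m⊑x , Sm , min with (S? e) ×-dec (e ⊑? m)
    ...   | yes (Se , e⊑m) = e , P.trans e⊑m m⊑x , Se , λ
            { (here t≈e) _ _ → t≈e
            ; (there t∈es) St t⊑e →
                P.antisym t⊑e (P.trans e⊑m (P.reflexive (P.Eq.sym (min t∈es St (P.trans t⊑e e⊑m))))) }
    ...   | no ¬p = m , m⊑x , Sm , λ
            { (here t≈e) St t⊑m → contradiction (resp t≈e St , P.trans (P.reflexive (P.Eq.sym t≈e)) t⊑m) ¬p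
            ; (there t∈es) St t⊑m → min t∈es St t⊑m }

module _ {n : ℕ} where

  -- By itself this allows a word without descents. Together with `Inv⁻¹ j (x , y)` it says that `j`
  -- has exactly one descent, which characterises the join-irreducible elements.
  OnlyDescent : Permutation′ n → Fin n → Fin n → Set
  OnlyDescent j x y = ∀ {c d} → Desc j c d → c ≡ x × d ≡ y

  only⇒desc : ∀ (j : Permutation′ n) {x y} → OnlyDescent j x y → Inv⁻¹ j (x , y) → Desc j x y
  only⇒desc j {x} {y} only q
    with descent-exists {s = Perm.id} {t = j} (λ {p} → id-least j {p})
           (λ j≤id → ℕₚ.<-asym (proj₁ q) (proj₂ (j≤id {x , y} q)))
  ... | c , d , δ , _ with only δ
  ...   | refl , refl = δ

  module _ {j : Permutation′ n} {x y : Fin n} (only : OnlyDescent j x y) where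
    private
      desc-at : ∀ {i k} → i ⋯ k → (j ⟨$⟩ʳ k) Fin.< (j ⟨$⟩ʳ i) → i ≡ pos j y × k ≡ pos j x
      desc-at {i} {k} e p with only (p , subst₂ _⋯_ (sym (inverseˡ j)) (sym (inverseˡ j)) e)
      ... | ek , ei = trans (sym (inverseˡ j)) (cong (pos j) ei) , trans (sym (inverseˡ j)) (cong (pos j) ek)

      -- `C` confines both positions to a stretch of the word. Letters increase along a stretch that
      -- does not contain both places of the only descent.
      increasing : (C : Fin n → Fin n → Set) → (∀ {i k l} → i Fin.< k → k Fin.< l → C i l → C i k × C k l) →
        (∀ {i k} → i ⋯ k → C i k → ¬ (i ≡ pos j y × k ≡ pos j x)) →
        ∀ {i k} → i Fin.< k → C i k → (j ⟨$⟩ʳ i) Fin.< (j ⟨$⟩ʳ k)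
      increasing C split avoid {i} {k} i<k = proj₂ (⋯-ind
        (λ i k → i Fin.< k × (C i k → (j ⟨$⟩ʳ i) Fin.< (j ⟨$⟩ʳ k)))
        (λ (p , f) (q , g) → ℕₚ.<-trans p q , λ c →
          let c₁ , c₂ = split p q c in ℕₚ.<-trans (f c₁) (g c₂))
        (λ e → ⋯⇒< e , λ c → step e c) i<k)
        where
        step : ∀ {i k} → i ⋯ k → C i k → (j ⟨$⟩ʳ i) Fin.< (j ⟨$⟩ʳ k)
        step {i} {k} e c with Finₚ.<-cmp (j ⟨$⟩ʳ i) (j ⟨$⟩ʳ k)
        ... | tri< p _ _ = p
        ... | tri≈ _ p _ = contradiction (trans (sym (inverseˡ j)) (trans (cong (pos j) p) (inverseˡ j)))
                             (Finₚ.<⇒≢ (⋯⇒< e))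
        ... | tri> _ _ p = contradiction (desc-at e p) (avoid e c)

    increasingˡ : ∀ {c d} → Before j c d → pos j d Fin.≤ pos j y → c Fin.< d
    increasingˡ {c} {d} p q = subst₂ Fin._<_ (inverseʳ j) (inverseʳ j)
      (increasing (λ _ k → k Fin.≤ pos j y)
        (λ _ p q → ℕₚ.≤-trans (ℕₚ.<⇒≤ p) q , q)
        (λ { e k≤y (refl , _) → ℕₚ.<-irrefl refl (ℕₚ.<-≤-trans (⋯⇒< e) k≤y) }) p q)

    increasingʳ : ∀ {c d} → Before j c d → pos j x Fin.≤ pos j c → c Fin.< d
    increasingʳ {c} {d} p q = subst₂ Fin._<_ (inverseʳ j) (inverseʳ j)
      (increasing (λ i _ → pos j x Fin.≤ i)
        (λ p _ q → q , ℕₚ.≤-trans q (ℕₚ.<⇒≤ p))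
        (λ { e x≤i (_ , refl) → ℕₚ.<-irrefl refl (ℕₚ.<-≤-trans (⋯⇒< e) x≤i) }) p q)

  -- The word `j` is an increasing run ending in `y` followed by one beginning with `x`. An
  -- inversion `c < d` of `j` has `d` in the first run and `c` in the second, so `x ≤ c < d ≤ y`. If
  -- `y` preceded `d` in `z`, so would the adjacent letter `x`, and then `x` would precede `d` in
  -- `j` as well. Hence `d` is not after `y` in `z`, nor in `t`; dually `c` is not before `x`. As
  -- `t` puts `y` before `x`, it inverts `(c , d)`.
  only-descent-least : ∀ {j z t : Permutation′ n} {x y} → OnlyDescent j x y → Inv⁻¹ j (x , y) →
    Desc z x y → j ≤ʷ z → t ≤ʷ z → Inv⁻¹ t (x , y) → j ≤ʷ t
  only-descent-least {j} {z} {t} {x} {y} only xy∈j (_ , adj) j≤z t≤z (_ , y<x) {c , d} (c<d , p) =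
    c<d , ℕₚ.≤-<-trans d≤y (ℕₚ.<-≤-trans y<x x≤c)
    where
    δ : Desc j x y
    δ = only⇒desc j only xy∈j
    d⊑y : pos j d Fin.≤ pos j y
    d⊑y = ℕₚ.≮⇒≥ λ q → ℕₚ.<-asym c<d
      (increasingʳ {j} only p (subst (_≤ toℕ (pos j d)) (sym (proj₂ δ)) q))
    x⊑c : pos j x Fin.≤ pos j c
    x⊑c = ℕₚ.≮⇒≥ λ q → ℕₚ.<-asym c<d
      (increasingˡ {j} only p (ℕ.s≤s⁻¹ (subst (suc (toℕ (pos j c)) ≤_) (proj₂ δ) q)))
    before⇒≤ : ∀ {a b} → pos j a Fin.≤ pos j b → a ≡ b ⊎ Before j a b
    before⇒≤ {a} {b} a≤b with a Finₚ.≟ b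
    ... | yes a≡b = inj₁ a≡b
    ... | no a≢b = inj₂ (ℕₚ.≤∧≢⇒< a≤b (a≢b ∘ pos-injective j ∘ Finₚ.toℕ-injective))
    d≼y : d ≡ y ⊎ d Fin.< y
    d≼y with before⇒≤ d⊑y
    ... | inj₁ e = inj₁ e
    ... | inj₂ q = inj₂ (increasingˡ {j} only q ℕₚ.≤-refl)
    x≼c : x ≡ c ⊎ x Fin.< c
    x≼c with before⇒≤ x⊑c
    ... | inj₁ e = inj₁ e
    ... | inj₂ q = inj₂ (increasingʳ {j} only q ℕₚ.≤-refl)
    x<d : x Fin.< d
    x<d with x≼c
    ... | inj₁ refl = c<d
    ... | inj₂ q = ℕₚ.<-trans q c<d
    c<y : c Fin.< y
    c<y with d≼y
    ... | inj₁ refl = c<d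
    ... | inj₂ q = ℕₚ.<-trans c<d q
    d≤y : pos t d Fin.≤ pos t y
    d≤y with d≼y
    ... | inj₁ refl = ℕₚ.≤-refl
    ... | inj₂ d<y with before-total z (Finₚ.<⇒≢ d<y)
    ...   | inj₁ q = ℕₚ.<⇒≤ (before-mono {u = t} {v = z} t≤z d<y q)
    ...   | inj₂ q = contradiction
              (before-mono {u = j} {v = z} j≤z x<d
                (adj-beforeʳ z (inj₁ adj) (Finₚ.<⇒≢ d<y) (Finₚ.<⇒≢ x<d ∘ sym) q))
              (ℕₚ.<-asym (ℕₚ.≤-<-trans d⊑y (⋯⇒< (proj₂ δ))))
    x≤c : pos t x Fin.≤ pos t c
    x≤c with x≼c
    ... | inj₁ refl = ℕₚ.≤-refl
    ... | inj₂ x<c with before-total z (Finₚ.<⇒≢ x<c)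
    ...   | inj₁ q = ℕₚ.<⇒≤ (before-mono {u = t} {v = z} t≤z x<c q)
    ...   | inj₂ q = contradiction
              (before-mono {u = j} {v = z} j≤z c<y
                (adj-beforeˡ z (inj₂ adj) (Finₚ.<⇒≢ x<c ∘ sym) (Finₚ.<⇒≢ c<y) q))
              (ℕₚ.<-asym (ℕₚ.<-≤-trans (⋯⇒< (proj₂ δ)) x⊑c))

  module _ (w : Permutation′ n) where
    open FinitePoset [e, w ] using (Carrier; _⊑_; poset)
    open Order poset using (IsJoin; IsLabel)

    step⇒join : (u z t : Carrier) → ∀ {x y} → Step (proj₁ u) (proj₁ z) x y → t ⊑ z →
                Inv⁻¹ (proj₁ t) (x , y) → IsJoin u t z
    step⇒join (u , _) (z , _) (t , _) {x} {y} st t≤z xy∈t =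
      (λ {p} → Step.below st {p}) , (λ {p} → t≤z {p}) ,
      λ (s , _) u≤s t≤s → λ { {c , d} q → lub s u≤s t≤s (Step.only st q) }
      where
      lub : ∀ s → u ≤ʷ s → t ≤ʷ s → ∀ {c d} → Inv⁻¹ u (c , d) ⊎ (c ≡ x × d ≡ y) → Inv⁻¹ s (c , d)
      lub s u≤s t≤s {c} {d} (inj₁ q) = u≤s {c , d} q
      lub s u≤s t≤s (inj₂ (refl , refl)) = t≤s {x , y} xy∈t

    -- Otherwise every inversion of `t` would be one of `u`, and the join would be `u` itself.
    join⇒inv : (u z t : Carrier) → ∀ {x y} → Step (proj₁ u) (proj₁ z) x y → IsJoin u t z →
               Inv⁻¹ (proj₁ t) (x , y)
    join⇒inv u z t {x} {y} st (_ , t≤z , lub) with inv⁻¹? (proj₁ t) x y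
    ... | yes q = q
    ... | no ¬q = contradiction
      (lub u (λ {p} q → q) (λ { {c , d} q → below q (Step.only st (t≤z {c , d} q)) })
        {x , y} (Desc⇒Inv⁻¹ (proj₁ z) (Step.desc st)))
      (Asc⇒¬Inv⁻¹ (proj₁ u) (Step.asc st))
      where
      below : ∀ {c d} → Inv⁻¹ (proj₁ t) (c , d) → Inv⁻¹ (proj₁ u) (c , d) ⊎ (c ≡ x × d ≡ y) →
              Inv⁻¹ (proj₁ u) (c , d)
      below _ (inj₁ q) = q
      below q (inj₂ (refl , refl)) = contradiction q ¬q

    -- Undoing any other descent of `j` would leave `(x , y)` inverted and give a strictly smaller
    -- element.
    minimal⇒only : (z j : Carrier) → ∀ {x y} → j ⊑ z → Inv⁻¹ (proj₁ j) (x , y) →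
      (∀ t → t ⊑ z → Inv⁻¹ (proj₁ t) (x , y) → t ⊑ j → j ⊑ t) → OnlyDescent (proj₁ j) x y
    minimal⇒only (z , _) (j , _ , j≤w) {x} {y} j≤z xy∈j min {c} {d} δ = byStep (Step.only st xy∈j)
      where
      st : Step (swap j c d) j c d
      st = step-down {z = j} δ
      byStep : Inv⁻¹ (swap j c d) (x , y) ⊎ (x ≡ c × y ≡ d) → c ≡ x × d ≡ y
      byStep (inj₂ (x≡c , y≡d)) = sym x≡c , sym y≡d
      byStep (inj₁ q) = contradiction
        (min (member w (swap j c d) (λ {p} → j≤w {p} ∘ Step.below st {p}))
          (λ {p} → j≤z {p} ∘ Step.below st {p}) q (λ {p} → Step.below st {p})
          {c , d} (Desc⇒Inv⁻¹ j δ))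
        (Asc⇒¬Inv⁻¹ (swap j c d) (Step.asc st))

    -- A search provides a minimal element below `z` that inverts the pair. Minimality forces a
    -- single descent, and the single descent makes the element least.
    label-exists : (u z : Carrier) → ∀ {x y} → Step (proj₁ u) (proj₁ z) x y → ∃ (IsLabel u z)
    label-exists u z {x} {y} st
      with below-minimal [e, w ] {S = λ t → Inv⁻¹ (proj₁ t) (x , y)} (λ t → inv⁻¹? (proj₁ t) x y)
             (λ {s} {t} s≈t q → ≈⇒≤ {u = proj₁ s} {v = proj₁ t} s≈t {x , y} q)
             z (Desc⇒Inv⁻¹ (proj₁ z) (Step.desc st))
    ... | j , j≤z , xy∈j , min = j , step⇒join u z j st (λ {p} → j≤z {p}) xy∈j ,
      λ t t-join → only-descent-least {proj₁ j} {proj₁ z} {proj₁ t} only xy∈j (Step.desc st)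
        j≤z (proj₁ (proj₂ t-join)) (join⇒inv u z t st t-join)
      where
      only : OnlyDescent (proj₁ j) x y
      only = minimal⇒only z j j≤z xy∈j λ t _ q t≤j →
        ≈⇒≤ {u = proj₁ j} {v = proj₁ t} (FinitePoset.Eq.sym [e, w ] {t} {j} (min t q t≤j))

    label⇒only : (u z j : Carrier) → ∀ {x y} → Step (proj₁ u) (proj₁ z) x y → IsLabel u z j →
                 OnlyDescent (proj₁ j) x y × Inv⁻¹ (proj₁ j) (x , y)
    label⇒only u z j st (join , least) =
      (minimal⇒only z j (proj₁ (proj₂ join)) xy∈j
        λ t t≤z q _ → least t (step⇒join u z t st t≤z q)) , xy∈j
      where xy∈j = join⇒inv u z j st join

-- Weights of exchanges

module _ {n : ℕ} (w : Permutation′ n) where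
  open FinitePoset [e, w ] using (Carrier; poset)
  open Order poset using (IsLabel; Dγ; Uγ)

  -- j labels both an upper cover u ⋖ z and a lower cover of v.
  record Transfer (u v : Permutation′ n) (x y : Fin n) : Set where
    field
      {z j} : Permutation′ n
      step  : Step u z x y
      j≤z   : j ≤ʷ z
      j≤v   : j ≤ʷ v
      z≤w   : z ≤ʷ w
      desc  : Desc v x y
      descⱼ : Desc j x y

  private
    -- The pair exchanged along an edge is the only descent of the label, so two edges with the same
    -- label exchange the same letters.
    transfer : (u z s v j : Carrier) → ∀ {x y} → Step (proj₁ u) (proj₁ z) x y → IsLabel u z j →
      ∀ {c d} → Step (proj₁ s) (proj₁ v) c d → IsLabel s v j →
      (c ≡ x × d ≡ y) × Transfer (proj₁ u) (proj₁ v) x y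
    transfer u z s v j st lab st′ lab′
      with label⇒only w u z j st lab | label⇒only w s v j st′ lab′
    ... | only , p | only′ , p′ with only (only⇒desc (proj₁ j) only′ p′)
    ...   | refl , refl = (refl , refl) , record
      { z = proj₁ z ; j = proj₁ j ; step = st
      ; j≤z = λ {p} → proj₁ (proj₂ (proj₁ lab)) {p} ; j≤v = λ {p} → proj₁ (proj₂ (proj₁ lab′)) {p}
      ; z≤w = λ {p} → proj₂ (proj₂ z) {p} ; desc = Step.desc st′ ; descⱼ = only⇒desc (proj₁ j) only p }

  module _ (u v : Carrier) (D≐U : Dγ v ≐ Uγ u) where

    -- The condition on `w` keeps the exchanged word inside the interval. The label of the new edge
    -- then reappears on an edge below `v`.
    asc⇒transfer : ∀ {x y} → Asc (proj₁ u) x y → Inv⁻¹ w (x , y) → Transfer (proj₁ u) (proj₁ v) x y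
    asc⇒transfer {x} {y} a xy∈w =
      let j , lab         = label-exists w u z st
          s , s⋖v , lab′  = proj₂ D≐U {j} (z , step⇒cover w u z st , lab)
          c , d , st′     = cover⇒step w s v s⋖v
      in proj₂ (transfer u z s v j st lab st′ lab′)
      where
      st = step-up {u = proj₁ u} a
      z≤w : ∀ {c d} → Inv⁻¹ (proj₁ u) (c , d) ⊎ (c ≡ x × d ≡ y) → Inv⁻¹ w (c , d)
      z≤w {c} {d} (inj₁ q) = proj₂ (proj₂ u) {c , d} q
      z≤w (inj₂ (refl , refl)) = xy∈w
      z = member w (swap (proj₁ u) x y) λ { {c , d} q → z≤w (Step.only st q) }

    desc⇒transfer : ∀ {x y} → Desc (proj₁ v) x y → Transfer (proj₁ u) (proj₁ v) x y
    desc⇒transfer {x} {y} δ =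
      let j , lab         = label-exists w s v st
          z , u⋖z , lab′  = proj₁ D≐U {j} (s , step⇒cover w s v st , lab)
          c , d , st′     = cover⇒step w u z u⋖z
          (x≡ , y≡) , t   = transfer u z s v j st′ lab′ st lab
      in subst₂ (Transfer (proj₁ u) (proj₁ v)) (sym x≡) (sym y≡) t
      where
      st = step-down {z = proj₁ v} δ
      s  = member w (swap (proj₁ v) x y) λ {p} → proj₂ (proj₂ v) {p} ∘ Step.below st {p}

module _ {n : ℕ} (w : Permutation′ n) where

  Δ : Fin n → Fin n → Set
  Δ x y = Inv⁻¹ w (x , y)

  Δ? : ∀ x y → Dec (Δ x y)
  Δ? = inv⁻¹? w

  Δ-irrefl : ∀ {x} → ¬ Δ x x
  Δ-irrefl (p , _) = ℕₚ.<-irrefl refl p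

  ¬Δ⇒before : ∀ {u : Permutation′ n} → u ≤ʷ w → ∀ {x y} → x Fin.< y → ¬ Δ x y → Before u x y
  ¬Δ⇒before {u} u≤w {x} {y} x<y ¬δ with before-total u (Finₚ.<⇒≢ x<y)
  ... | inj₁ q = q
  ... | inj₂ q = contradiction (u≤w {x , y} (x<y , q)) ¬δ

  -- Only ascents in `Δ` lead to upper covers inside `[e, w]`, whereas every descent of an element
  -- of the interval lies in `Δ`.
  asc? : ∀ (u : Permutation′ n) x y → Dec (Asc u x y × Δ x y)
  asc? u x y = ((x Finₚ.<? y) ×-dec (pos u x ⋯? pos u y)) ×-dec Δ? x y

  desc? : ∀ (u : Permutation′ n) x y → Dec (Desc u x y)
  desc? u x y = (x Finₚ.<? y) ×-dec (pos u y ⋯? pos u x)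

  -- For adjacent letters x and y: whether z lies left of the gap between them when x is put first.
  cut : Permutation′ n → Fin n → Fin n → Fin n → ℤ
  cut u x y z with z Finₚ.≟ x | z Finₚ.≟ y
  ... | yes _ | _     = 1ℤ
  ... | no _  | yes _ = 0ℤ
  ... | no _  | no _  = ⟦ pos u z Finₚ.<? pos u x ⟧

  -- To pass the gap, `z` must be exchanged with both `x` and `y`. For `z < x` or `y < z` the
  -- hypotheses forbid one of these exchanges. For `x < z < y` the passage inverts one pair and
  -- restores the other, which cannot happen between `s ≤ t`.
  cut-invariant : ∀ {s t : Permutation′ n} → s ≤ʷ t → t ≤ʷ w → ∀ {x y} → Adj s x y → Adj t x y →
    ∀ z → (z Fin.< x → ¬ Δ z x) → (y Fin.< z → ¬ Δ y z) → cut s x y z ≡ cut t x y z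
  cut-invariant {s} {t} s≤t t≤w {x} {y} as at z low high with z Finₚ.≟ x | z Finₚ.≟ y
  ... | yes _  | _       = refl
  ... | no _   | yes _   = refl
  ... | no z≢x | no z≢y  = ⟦⟧-cong (pos s z Finₚ.<? pos s x) (pos t z Finₚ.<? pos t x) to from
    where
    s≤w : s ≤ʷ w
    s≤w {p} q = t≤w {p} (s≤t {p} q)
    to : Before s z x → Before t z x
    to p with Finₚ.<-cmp z x
    ... | tri< z<x _ _ = ¬Δ⇒before {t} t≤w z<x (low z<x)
    ... | tri≈ _ z≡x _ = contradiction z≡x z≢x
    ... | tri> _ _ x<z = proj₂ (s≤t {x , z} (x<z , p))
    from : Before t z x → Before s z x
    from p with Finₚ.<-cmp z x
    ... | tri< z<x _ _ = ¬Δ⇒before {s} s≤w z<x (low z<x)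
    ... | tri≈ _ z≡x _ = contradiction z≡x z≢x
    ... | tri> _ _ x<z with before-total s z≢x
    ...   | inj₁ q = q
    ...   | inj₂ q with Finₚ.<-cmp z y
    ...     | tri< z<y _ _ = contradiction (proj₂ (s≤t {z , y} (z<y , adj-beforeʳ s as z≢x z≢y q)))
                               (ℕₚ.<-asym (adj-beforeˡ t at z≢x z≢y p))
    ...     | tri≈ _ z≡y _ = contradiction z≡y z≢y
    ...     | tri> _ _ y<z = contradiction
                (adj-beforeʳ t (adj-sym t at) z≢y z≢x (¬Δ⇒before {t} t≤w y<z (high y<z)))
                (ℕₚ.<-asym p)

  module Weight {m : ℕ} (X Y : Fin m → Fin n)
    (box  : ∀ τ → Δ (X τ) (Y τ))
    (full : ∀ τ {l r} → Δ l (Y τ) → Δ (X τ) r → Δ l r)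
    where

    weight : Permutation′ n → Fin n → Fin n → ℤ
    weight u x y = ∑[ τ < m ] (⟦ Δ? x (Y τ) ⟧ ℤ.* (⟦ Δ? (X τ) y ⟧ ℤ.* (cut u x y (X τ) ℤ.- cut u x y (Y τ))))

    weight-invariant : ∀ {s t : Permutation′ n} → s ≤ʷ t → t ≤ʷ w → ∀ {x y} → Adj s x y → Adj t x y →
                       weight s x y ≡ weight t x y
    weight-invariant {s} {t} s≤t t≤w {x} {y} as at = sum-cong-≗ term
      where
      term : ∀ τ → ⟦ Δ? x (Y τ) ⟧ ℤ.* (⟦ Δ? (X τ) y ⟧ ℤ.* (cut s x y (X τ) ℤ.- cut s x y (Y τ)))
                 ≡ ⟦ Δ? x (Y τ) ⟧ ℤ.* (⟦ Δ? (X τ) y ⟧ ℤ.* (cut t x y (X τ) ℤ.- cut t x y (Y τ)))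
      term τ with Δ? x (Y τ) | Δ? (X τ) y
      ... | no _  | _    = refl
      ... | yes _ | no _ = refl
      -- `X` is smaller than `y`, and `Δ X x` together with `Δ x Y` would give `Δ x x`. The argument
      -- for `Y` is dual.
      ... | yes p | yes q = cong (λ z → 1ℤ ℤ.* (1ℤ ℤ.* z)) (cong₂ ℤ._-_
        (cut-invariant {s} {t} s≤t t≤w as at (X τ)
          (λ _ δ → Δ-irrefl (full τ p δ)) (λ y<X _ → ℕₚ.<-asym y<X (proj₁ q)))
        (cut-invariant {s} {t} s≤t t≤w as at (Y τ)
          (λ Y<x _ → ℕₚ.<-asym Y<x (proj₁ p)) (λ _ δ → Δ-irrefl (full τ δ q))))

    -- The label `j` lies below both upper ends, so `u ≤ z ≥ j ≤ v` is a path of comparable words in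
    -- each of which the two letters are adjacent.
    weight-transfer : ∀ {u v : Permutation′ n} → v ≤ʷ w → ∀ {x y} → Transfer w u v x y →
                      weight u x y ≡ weight v x y
    weight-transfer {u} {v} v≤w {x} {y} tr = trans
      (weight-invariant {u} {z} (Step.below step) z≤w (inj₁ (proj₂ (Step.asc step))) (inj₂ (proj₂ (Step.desc step))))
      (trans (sym (weight-invariant {j} {z} j≤z z≤w (inj₂ (proj₂ descⱼ)) (inj₂ (proj₂ (Step.desc step)))))
             (weight-invariant {j} {v} j≤v v≤w (inj₂ (proj₂ descⱼ)) (inj₂ (proj₂ desc))))
      where open Transfer tr

-- The crossing identity

private
  diff-alg : ∀ A b₁ b₂ d → A ℤ.* ((b₁ ℤ.- b₂) ℤ.* d) ≡ A ℤ.* (b₁ ℤ.* d) ℤ.- A ℤ.* (b₂ ℤ.* d)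
  diff-alg = solve-∀
  ends-alg : ∀ L x y → (L ℤ.- x) ℤ.- (L ℤ.- y) ≡ y ℤ.- x
  ends-alg = solve-∀
  crossing-alg : ∀ hr hl b →
    b ℤ.* (hr ℤ.- hl) ≡ (1ℤ ℤ.- hl) ℤ.* (hr ℤ.* b) ℤ.- (1ℤ ℤ.- hr) ℤ.* (hl ℤ.* b)
  crossing-alg = solve-∀
  *-distrib-- : ∀ a b c → a ℤ.* (b ℤ.- c) ≡ a ℤ.* b ℤ.- a ℤ.* c
  *-distrib-- = solve-∀

-- The value at the last position is hidden in `L`, so that the empty word is covered as well.
telescopes : ∀ {n} (g : Fin n → ℤ) → ∃ λ L → ∀ m →
  ∑[ i < n ] ∑[ j < n ] (⟦ i ⋯? j ⟧ ℤ.* (⟦ m Finₚ.≤? i ⟧ ℤ.* (g j ℤ.- g i))) ≡ L ℤ.- g m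
telescopes {zero}  g = 0ℤ , λ ()
telescopes {suc n} g = g (Fin.fromℕ n) , telescope g

module _ {n : ℕ} (u : Permutation′ n) where

  sum-positions : (F : Fin n → Fin n → ℤ) →
    ∑[ i < n ] ∑[ j < n ] F i j ≡ ∑[ x < n ] ∑[ y < n ] F (pos u x) (pos u y)
  sum-positions F = trans (sum-permute (λ i → ∑[ j < n ] F i j) (Perm.flip u))
    (sum-cong-≗ {n} λ x → sum-permute (F (pos u x)) (Perm.flip u))

  telescopes-letters : (h : Fin n → ℤ) → ∃ λ L → ∀ z →
    ∑[ l < n ] ∑[ r < n ] (⟦ pos u l ⋯? pos u r ⟧ ℤ.* (⟦ pos u z Finₚ.≤? pos u l ⟧ ℤ.* (h r ℤ.- h l)))
      ≡ L ℤ.- h z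
  telescopes-letters h with telescopes (λ i → h (u ⟨$⟩ʳ i))
  ... | L , tel = L , λ z → trans
    (sum-cong-≗ {n} λ l → sum-cong-≗ {n} λ r → cong (λ d → ⟦ pos u l ⋯? pos u r ⟧ ℤ.* (⟦ pos u z Finₚ.≤? pos u l ⟧ ℤ.* d))
      (cong₂ (λ a b → h a ℤ.- h b) (sym (inverseʳ u)) (sym (inverseʳ u))))
    (trans (sym (sum-positions (λ i j → ⟦ i ⋯? j ⟧ ℤ.* (⟦ pos u z Finₚ.≤? i ⟧ ℤ.* (h (u ⟨$⟩ʳ j) ℤ.- h (u ⟨$⟩ʳ i))))))
      (trans (tel (pos u z)) (cong (λ a → L ℤ.- h a) (inverseʳ u))))

module _ {n : ℕ} {w : Permutation′ n} {u : Permutation′ n} (u≤w : u ≤ʷ w) where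

  -- Suppose that neither relation holds. If `v < x`, then `v` precedes `y`, hence `x`, in `w`, and
  -- so precedes both in `u`. The case `y < v` is the mirror image. If `x < v < y`, then `w` would
  -- put `x` before `v` and `v` before `y`, against `Δ w x y`.
  between : ∀ {x y v} → Δ w x y →
    ¬ (Before u v x × Before u v y) → ¬ (Before u x v × Before u y v) → Δ w v y ⊎ Δ w x v
  between {x} {y} {v} (x<y , y≺x) ¬left ¬right with Δ? w v y | Δ? w x v
  ... | yes δ | _     = inj₁ δ
  ... | no _  | yes δ = inj₂ δ
  ... | no ¬vy | no ¬xv with Finₚ.<-cmp v x | Finₚ.<-cmp v y
  ...   | tri≈ _ refl _ | _ = contradiction (x<y , y≺x) ¬vy
  ...   | _ | tri≈ _ refl _ = contradiction (x<y , y≺x) ¬xv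
  ...   | tri< v<x _ _ | _ = contradiction
            (¬Δ⇒before w {u} u≤w v<x (λ (_ , x≺v) → ¬vy (ℕₚ.<-trans v<x x<y , ℕₚ.<-trans y≺x x≺v)) ,
             ¬Δ⇒before w {u} u≤w (ℕₚ.<-trans v<x x<y) ¬vy) ¬left
  ...   | _ | tri> _ _ y<v = contradiction
            (¬Δ⇒before w {u} u≤w (ℕₚ.<-trans x<y y<v) ¬xv ,
             ¬Δ⇒before w {u} u≤w y<v (λ (_ , v≺y) → ¬xv (ℕₚ.<-trans x<y y<v , ℕₚ.<-trans v≺y y≺x))) ¬right
  ...   | tri> _ _ x<v | tri< v<y _ _ = contradiction y≺x (ℕₚ.<-asym (ℕₚ.<-trans
            (¬Δ⇒before w {w} (λ {p} q → q) x<v ¬xv) (¬Δ⇒before w {w} (λ {p} q → q) v<y ¬vy)))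

  module Identity {m : ℕ} (X Y : Fin m → Fin n)
    (box  : ∀ τ → Δ w (X τ) (Y τ))
    (full : ∀ τ {l r} → Δ w l (Y τ) → Δ w (X τ) r → Δ w l r)
    (c : ℤ)
    (count : ∀ {x y} → Δ w x y →
             ∑[ τ < m ] (⟦ X τ Finₚ.≟ x ⟧ ℤ.+ ⟦ Y τ Finₚ.≟ y ⟧) ≡ c)
    where
    open Weight w X Y box full

    -- This tells whether `z` lies left of the gap that follows `l`.
    β : Fin n → Fin n → ℤ
    β l z = ⟦ pos u z Finₚ.≤? pos u l ⟧

    -- `h τ` is the indicator of the high letters and `g τ` that of the low ones.
    h : Fin m → Fin n → ℤ
    h τ v = ⟦ Δ? w (X τ) v ⟧

    g : Fin m → Fin n → ℤ
    g τ v = ⟦ Δ? w v (Y τ) ⟧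

    -- At the gap between `l` and `r`, `up` records a step from low to high and `down` one from high
    -- to low. The sign is positive if the gap lies after `X` and before `Y`, and negative in the
    -- opposite order.
    up down : Fin m → Fin n → Fin n → ℤ
    up   τ l r = g τ l ℤ.* (h τ r ℤ.* (β l (X τ) ℤ.- β l (Y τ)))
    down τ l r = g τ r ℤ.* (h τ l ℤ.* (β l (X τ) ℤ.- β l (Y τ)))

    disjoint : ∀ τ {v} → Δ w v (Y τ) → Δ w (X τ) v → ⊥
    disjoint τ p q = Δ-irrefl w (full τ p q)

    g≡1-h : ∀ τ {v} → Δ w v (Y τ) ⊎ Δ w (X τ) v → g τ v ≡ 1ℤ ℤ.- h τ v
    g≡1-h τ {v} d with Δ? w v (Y τ) | Δ? w (X τ) v | d
    ... | yes p | yes q | _ = ⊥-elim (disjoint τ p q)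
    ... | yes _ | no _  | _ = refl
    ... | no _  | yes _ | _ = refl
    ... | no ¬p | no _  | inj₁ p = contradiction p ¬p
    ... | no _  | no ¬q | inj₂ q = contradiction q ¬q

    -- Both sides vanish if the gap is not between `X` and `Y`. Otherwise neither neighbour of the
    -- gap lies outside the stretch from `X` to `Y`, so `g` is `1 - h` at both and the identity is
    -- algebra.
    crossing : ∀ τ {l r} → pos u l ⋯ pos u r →
      (β l (X τ) ℤ.- β l (Y τ)) ℤ.* (h τ r ℤ.- h τ l) ≡ up τ l r ℤ.- down τ l r
    crossing τ {l} {r} e = byCut (pos u (X τ) Finₚ.≤? pos u l) (pos u (Y τ) Finₚ.≤? pos u l)
      where
      byRing : Δ w l (Y τ) ⊎ Δ w (X τ) l → Δ w r (Y τ) ⊎ Δ w (X τ) r →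
        (β l (X τ) ℤ.- β l (Y τ)) ℤ.* (h τ r ℤ.- h τ l) ≡ up τ l r ℤ.- down τ l r
      byRing dl dr rewrite g≡1-h τ dl | g≡1-h τ dr =
        crossing-alg (h τ r) (h τ l) (β l (X τ) ℤ.- β l (Y τ))
      trivial : β l (X τ) ≡ β l (Y τ) →
        (β l (X τ) ℤ.- β l (Y τ)) ℤ.* (h τ r ℤ.- h τ l) ≡ up τ l r ℤ.- down τ l r
      trivial eq rewrite eq | ℤₚ.+-inverseʳ (β l (Y τ))
        | ℤₚ.*-zeroʳ (h τ r) | ℤₚ.*-zeroʳ (h τ l) | ℤₚ.*-zeroʳ (g τ r) | ℤₚ.*-zeroʳ (g τ l) = refl
      l<r : Before u l r
      l<r = ⋯⇒< e
      next : ∀ {z} → ¬ (pos u z Fin.≤ pos u l) → pos u r Fin.≤ pos u z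
      next {z} p = subst (_≤ toℕ (pos u z)) (sym e) (ℕₚ.≰⇒> p)
      byCut : Dec (pos u (X τ) Fin.≤ pos u l) → Dec (pos u (Y τ) Fin.≤ pos u l) →
        (β l (X τ) ℤ.- β l (Y τ)) ℤ.* (h τ r ℤ.- h τ l) ≡ up τ l r ℤ.- down τ l r
      byCut (yes p) (yes q) = trivial (trans (⟦⟧-yes (_ Finₚ.≤? _) p) (sym (⟦⟧-yes (_ Finₚ.≤? _) q)))
      byCut (no p)  (no q)  = trivial (trans (⟦⟧-no (_ Finₚ.≤? _) p) (sym (⟦⟧-no (_ Finₚ.≤? _) q)))
      byCut (yes p) (no q)  = byRing
        (between (box τ) (λ (a , _) → ℕₚ.<⇒≱ a p) (λ (_ , b) → q (ℕₚ.<⇒≤ b)))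
        (between (box τ) (λ (a , _) → ℕₚ.<⇒≱ (ℕₚ.<-trans l<r a) p) (λ (_ , b) → ℕₚ.<⇒≱ b (next q)))
      byCut (no p)  (yes q) = byRing
        (between (box τ) (λ (_ , b) → ℕₚ.<⇒≱ b q) (λ (a , _) → p (ℕₚ.<⇒≤ a)))
        (between (box τ) (λ (_ , b) → ℕₚ.<⇒≱ (ℕₚ.<-trans l<r b) q) (λ (a , _) → ℕₚ.<⇒≱ a (next p)))

    -- The changes of `h` over the gaps between `X` and `Y` telescope to `h Y - h X`, and `Y` is
    -- high while `X` is not.
    one-turn : ∀ τ →
      ∑[ l < n ] ∑[ r < n ] (⟦ pos u l ⋯? pos u r ⟧ ℤ.* (up τ l r ℤ.- down τ l r)) ≡ 1ℤ
    one-turn τ with telescopes-letters u (h τ)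
    ... | L , tel = begin
      ∑[ l < n ] ∑[ r < n ] (⟦ pos u l ⋯? pos u r ⟧ ℤ.* (up τ l r ℤ.- down τ l r))
        ≡⟨ sum-cong-≗ {n} (λ l → trans (sum-cong-≗ {n} (term l)) (∑-distrib-- (S l (X τ)) (S l (Y τ)))) ⟩
      ∑[ l < n ] (∑[ r < n ] S l (X τ) r ℤ.- ∑[ r < n ] S l (Y τ) r)
        ≡⟨ ∑-distrib-- (λ l → ∑[ r < n ] S l (X τ) r) (λ l → ∑[ r < n ] S l (Y τ) r) ⟩
      ∑[ l < n ] ∑[ r < n ] S l (X τ) r ℤ.- ∑[ l < n ] ∑[ r < n ] S l (Y τ) r
        ≡⟨ cong₂ ℤ._-_ (tel (X τ)) (tel (Y τ)) ⟩
      (L ℤ.- h τ (X τ)) ℤ.- (L ℤ.- h τ (Y τ))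
        ≡⟨ ends-alg L (h τ (X τ)) (h τ (Y τ)) ⟩
      h τ (Y τ) ℤ.- h τ (X τ)
        ≡⟨ cong₂ ℤ._-_ (⟦⟧-yes (Δ? w (X τ) (Y τ)) (box τ)) (⟦⟧-no (Δ? w (X τ) (X τ)) (Δ-irrefl w)) ⟩
      1ℤ ∎
      where
      open ≡-Reasoning
      S : Fin n → Fin n → Fin n → ℤ
      S l z r = ⟦ pos u l ⋯? pos u r ⟧ ℤ.* (β l z ℤ.* (h τ r ℤ.- h τ l))
      term : ∀ l r → ⟦ pos u l ⋯? pos u r ⟧ ℤ.* (up τ l r ℤ.- down τ l r) ≡ S l (X τ) r ℤ.- S l (Y τ) r
      term l r with pos u l ⋯? pos u r
      ... | no _  = refl
      ... | yes e = trans (cong (1ℤ ℤ.*_) (sym (crossing τ e)))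
                          (diff-alg 1ℤ (β l (X τ)) (β l (Y τ)) (h τ r ℤ.- h τ l))

    cut-asc : ∀ {l r} → pos u l ⋯ pos u r → ∀ z → β l z ≡ cut w u l r z
    cut-asc {l} {r} e z with z Finₚ.≟ l | z Finₚ.≟ r
    ... | yes refl | _ = ⟦⟧-yes (_ Finₚ.≤? _) ℕₚ.≤-refl
    ... | no _ | yes refl = ⟦⟧-no (_ Finₚ.≤? _) (ℕₚ.<⇒≱ (⋯⇒< e))
    ... | no z≢l | no _ = ⟦⟧-cong (_ Finₚ.≤? _) (_ Finₚ.<? _)
      (λ p → ℕₚ.≤∧≢⇒< p (z≢l ∘ pos-injective u ∘ Finₚ.toℕ-injective)) ℕₚ.<⇒≤

    -- In the word itself `y` stands left of the gap and `x` right of it, while `cut` puts `x`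
    -- first. The two readings differ only at these letters.
    cut-desc : ∀ {x y} → Desc u x y → ∀ z →
      β y z ≡ cut w u x y z ℤ.- ⟦ z Finₚ.≟ x ⟧ ℤ.+ ⟦ z Finₚ.≟ y ⟧
    cut-desc {x} {y} (x<y , e) z with z Finₚ.≟ x | z Finₚ.≟ y
    ... | yes refl | yes refl = contradiction x<y (ℕₚ.<-irrefl refl)
    ... | yes refl | no _ = ⟦⟧-no (_ Finₚ.≤? _) (ℕₚ.<⇒≱ (⋯⇒< e))
    ... | no _ | yes refl = ⟦⟧-yes (_ Finₚ.≤? _) ℕₚ.≤-refl
    ... | no z≢x | no z≢y = trans
      (⟦⟧-cong (_ Finₚ.≤? _) (pos u z Finₚ.<? pos u x)
        (λ p → ℕₚ.≤-<-trans p (⋯⇒< e))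
        (λ p → ℕ.s≤s⁻¹ (subst (suc (toℕ (pos u z)) ≤_) e p)))
      (sym (trans (ℤₚ.+-identityʳ _) (ℤₚ.+-identityʳ _)))

    -- By `full`, a low `l` and a high `r` form a pair in `Δ`. Hence every nonzero term belongs to
    -- an ascent that `asc?` accepts.
    asc-sum : ∀ l r → ∑[ τ < m ] (⟦ pos u l ⋯? pos u r ⟧ ℤ.* up τ l r) ≡ ⟦ asc? w u l r ⟧ ℤ.* weight u l r
    asc-sum l r = trans (sum-cong-≗ {m} term) (sym (*-distribˡ-sum ⟦ asc? w u l r ⟧ W))
      where
      W : Fin m → ℤ
      W τ = g τ l ℤ.* (h τ r ℤ.* (cut w u l r (X τ) ℤ.- cut w u l r (Y τ)))
      vanish : ∀ τ b → ¬ Δ w l r → g τ l ℤ.* (h τ r ℤ.* b) ≡ 0ℤ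
      vanish τ b ¬δ with Δ? w l (Y τ) | Δ? w (X τ) r
      ... | no _  | _     = refl
      ... | yes _ | no _  = refl
      ... | yes p | yes q = contradiction (full τ p q) ¬δ
      term : ∀ τ → ⟦ pos u l ⋯? pos u r ⟧ ℤ.* up τ l r ≡ ⟦ asc? w u l r ⟧ ℤ.* W τ
      term τ with asc? w u l r
      ... | yes ((_ , e) , _) = cong₂ ℤ._*_ (⟦⟧-yes (_ ⋯? _) e)
              (cong₂ (λ a b → g τ l ℤ.* (h τ r ℤ.* (a ℤ.- b))) (cut-asc e (X τ)) (cut-asc e (Y τ)))
      ... | no ¬p with pos u l ⋯? pos u r
      ...   | no _  = refl
      ...   | yes e = trans (ℤₚ.*-identityˡ _)
              (vanish τ (β l (X τ) ℤ.- β l (Y τ)) (λ δ → ¬p ((proj₁ δ , e) , δ)))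

    -- Replacing the reading of the gap by `cut` subtracts one for each `τ` with `X τ = x` and one
    -- for each `τ` with `Y τ = y`. By `count` these corrections add up to `c`.
    desc-sum : ∀ x y → ∑[ τ < m ] (⟦ pos u y ⋯? pos u x ⟧ ℤ.* down τ y x)
                       ≡ ⟦ desc? w u x y ⟧ ℤ.* (weight u x y ℤ.- c)
    desc-sum x y with desc? w u x y
    ... | no ¬δ = trans (sum-cong-≗ {m} term) (sum-replicate-zero m)
      where
      term : ∀ τ → ⟦ pos u y ⋯? pos u x ⟧ ℤ.* down τ y x ≡ 0ℤ
      term τ with pos u y ⋯? pos u x | Δ? w x (Y τ) | Δ? w (X τ) y
      ... | no _  | _     | _     = refl
      ... | yes _ | no _  | _     = refl
      ... | yes _ | yes _ | no _  = refl
      ... | yes e | yes p | yes q = contradiction (proj₁ (full τ p q) , e) ¬δ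
    ... | yes δ = trans (sum-cong-≗ {m} term)
      (trans (∑-distrib-- W K)
        (trans (cong (λ k → weight u x y ℤ.- k) (count xy∈w)) (sym (ℤₚ.*-identityˡ _))))
      where
      xy∈w : Δ w x y
      xy∈w = u≤w (Desc⇒Inv⁻¹ u δ)
      W K : Fin m → ℤ
      W τ = g τ x ℤ.* (h τ y ℤ.* (cut w u x y (X τ) ℤ.- cut w u x y (Y τ)))
      K τ = ⟦ X τ Finₚ.≟ x ⟧ ℤ.+ ⟦ Y τ Finₚ.≟ y ⟧
      alg : ∀ a b c d x₁ x₂ y₁ y₂ →
        1ℤ ℤ.* (a ℤ.* (b ℤ.* ((c ℤ.- x₁ ℤ.+ x₂) ℤ.- (d ℤ.- y₁ ℤ.+ y₂))))
        ≡ a ℤ.* (b ℤ.* (c ℤ.- d)) ℤ.- (a ℤ.* (b ℤ.* x₁) ℤ.+ a ℤ.* (b ℤ.* y₂))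
          ℤ.+ (a ℤ.* (b ℤ.* x₂) ℤ.+ a ℤ.* (b ℤ.* y₁))
      alg = solve-∀
      -- If `X τ = x`, both factors are 1: `x` is low by `box`, and `y` is high because the descent
      -- lies in `Δ`.
      corner : ∀ τ → g τ x ℤ.* (h τ y ℤ.* ⟦ X τ Finₚ.≟ x ⟧) ≡ ⟦ X τ Finₚ.≟ x ⟧
      corner τ with X τ Finₚ.≟ x
      ... | no _ = trans (cong (g τ x ℤ.*_) (ℤₚ.*-zeroʳ (h τ y))) (ℤₚ.*-zeroʳ (g τ x))
      ... | yes refl = cong₂ (λ a b → a ℤ.* (b ℤ.* 1ℤ))
              (⟦⟧-yes (Δ? w (X τ) (Y τ)) (box τ)) (⟦⟧-yes (Δ? w (X τ) y) xy∈w)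
      corner′ : ∀ τ → g τ x ℤ.* (h τ y ℤ.* ⟦ Y τ Finₚ.≟ y ⟧) ≡ ⟦ Y τ Finₚ.≟ y ⟧
      corner′ τ with Y τ Finₚ.≟ y
      ... | no _ = trans (cong (g τ x ℤ.*_) (ℤₚ.*-zeroʳ (h τ y))) (ℤₚ.*-zeroʳ (g τ x))
      ... | yes refl = cong₂ (λ a b → a ℤ.* (b ℤ.* 1ℤ))
              (⟦⟧-yes (Δ? w x (Y τ)) xy∈w) (⟦⟧-yes (Δ? w (X τ) (Y τ)) (box τ))
      -- If `X τ = y`, then `y` is not high, as `Δ` is irreflexive.
      off : ∀ τ → g τ x ℤ.* (h τ y ℤ.* ⟦ X τ Finₚ.≟ y ⟧) ≡ 0ℤ
      off τ with X τ Finₚ.≟ y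
      ... | no _ = trans (cong (g τ x ℤ.*_) (ℤₚ.*-zeroʳ (h τ y))) (ℤₚ.*-zeroʳ (g τ x))
      ... | yes refl = trans (cong (λ b → g τ x ℤ.* (b ℤ.* 1ℤ)) (⟦⟧-no (Δ? w (X τ) (X τ)) (Δ-irrefl w)))
              (ℤₚ.*-zeroʳ (g τ x))
      off′ : ∀ τ → g τ x ℤ.* (h τ y ℤ.* ⟦ Y τ Finₚ.≟ x ⟧) ≡ 0ℤ
      off′ τ with Y τ Finₚ.≟ x
      ... | no _ = trans (cong (g τ x ℤ.*_) (ℤₚ.*-zeroʳ (h τ y))) (ℤₚ.*-zeroʳ (g τ x))
      ... | yes refl = cong (ℤ._* (h τ y ℤ.* 1ℤ)) (⟦⟧-no (Δ? w (Y τ) (Y τ)) (Δ-irrefl w))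
      term : ∀ τ → ⟦ pos u y ⋯? pos u x ⟧ ℤ.* down τ y x ≡ W τ ℤ.- K τ
      term τ = trans
        (cong₂ ℤ._*_ (⟦⟧-yes (_ ⋯? _) (proj₂ δ))
          (cong₂ (λ a b → g τ x ℤ.* (h τ y ℤ.* (a ℤ.- b))) (cut-desc δ (X τ)) (cut-desc δ (Y τ))))
        (trans (alg (g τ x) (h τ y) (cut w u x y (X τ)) (cut w u x y (Y τ))
                    ⟦ X τ Finₚ.≟ x ⟧ ⟦ X τ Finₚ.≟ y ⟧ ⟦ Y τ Finₚ.≟ x ⟧ ⟦ Y τ Finₚ.≟ y ⟧)
          (trans (cong₂ (λ s t → W τ ℤ.- s ℤ.+ t)
                   (cong₂ ℤ._+_ (corner τ) (corner′ τ)) (cong₂ ℤ._+_ (off τ) (off′ τ)))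
                 (ℤₚ.+-identityʳ _)))

    asc-weights desc-weights : ℤ
    asc-weights  = ∑[ x < n ] ∑[ y < n ] (⟦ asc? w u x y ⟧ ℤ.* weight u x y)
    desc-weights = ∑[ x < n ] ∑[ y < n ] (⟦ desc? w u x y ⟧ ℤ.* (weight u x y ℤ.- c))

    -- The signed turns are counted twice: gap by gap they give the two weight sums, and step by
    -- step of the antidiagonal each `τ` contributes one.
    balance : asc-weights ℤ.- desc-weights ≡ + m
    balance = begin
      asc-weights ℤ.- desc-weights
        -- The left letter of a descent is the larger one, so the descent sum is transposed to run
        -- over left and right neighbours.
        ≡⟨ cong (λ z → asc-weights ℤ.- z) (∑-comm (λ x y → ⟦ desc? w u x y ⟧ ℤ.* (weight u x y ℤ.- c))) ⟩
      asc-weights ℤ.- ∑[ l < n ] ∑[ r < n ] (⟦ desc? w u r l ⟧ ℤ.* (weight u r l ℤ.- c))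
        ≡⟨ ∑∑-distrib-- (λ l r → ⟦ asc? w u l r ⟧ ℤ.* weight u l r) (λ l r → ⟦ desc? w u r l ⟧ ℤ.* (weight u r l ℤ.- c)) ⟨
      ∑[ l < n ] ∑[ r < n ] (⟦ asc? w u l r ⟧ ℤ.* weight u l r ℤ.- ⟦ desc? w u r l ⟧ ℤ.* (weight u r l ℤ.- c))
        ≡⟨ sum-cong-≗ {n} (λ l → sum-cong-≗ {n} λ r → sym (trans
             (trans (sum-cong-≗ {m} λ τ → *-distrib-- ⟦ pos u l ⋯? pos u r ⟧ (up τ l r) (down τ l r))
                    (∑-distrib-- (λ τ → ⟦ pos u l ⋯? pos u r ⟧ ℤ.* up τ l r) (λ τ → ⟦ pos u l ⋯? pos u r ⟧ ℤ.* down τ l r)))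
             (cong₂ ℤ._-_ (asc-sum l r) (desc-sum r l)))) ⟩
      ∑[ l < n ] ∑[ r < n ] ∑[ τ < m ] T τ l r
        ≡⟨ sum-cong-≗ {n} (λ l → ∑-comm (λ r τ → T τ l r)) ⟩
      ∑[ l < n ] ∑[ τ < m ] ∑[ r < n ] T τ l r
        ≡⟨ ∑-comm (λ l τ → ∑[ r < n ] T τ l r) ⟩
      ∑[ τ < m ] ∑[ l < n ] ∑[ r < n ] T τ l r
        ≡⟨ sum-cong-≗ {m} one-turn ⟩
      ∑[ τ < m ] 1ℤ
        ≡⟨ trans (∑-const m 1ℤ) (ℤₚ.*-identityʳ (+ m)) ⟩
      + m ∎
      where
      open ≡-Reasoning
      T : Fin m → Fin n → Fin n → ℤ
      T τ l r = ⟦ pos u l ⋯? pos u r ⟧ ℤ.* (up τ l r ℤ.- down τ l r)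
      ∑∑-distrib-- : (p q : Fin n → Fin n → ℤ) → ∑[ l < n ] ∑[ r < n ] (p l r ℤ.- q l r)
        ≡ ∑[ l < n ] ∑[ r < n ] p l r ℤ.- ∑[ l < n ] ∑[ r < n ] q l r
      ∑∑-distrib-- p q = trans (sum-cong-≗ {n} λ l → ∑-distrib-- (p l) (q l))
        (∑-distrib-- (λ l → sum (p l)) (λ l → sum (q l)))

-- Counting lower covers and averaging over orbits

module _ (S : Setoid 0ℓ 0ℓ) where
  open Setoid S using (Carrier; _≈_) renaming (sym to ≈-sym)
  open Uniqueₛ S using (Unique)

  lookup-injective : ∀ {xs} → Unique xs → ∀ i j → lookup xs i ≈ lookup xs j → i ≡ j
  lookup-injective {x ∷ xs} (_ ∷ _) zero zero _ = refl
  lookup-injective {x ∷ xs} (x∉ ∷ _) zero (suc j) e = contradiction e (All.lookup x∉ (∈-lookup j))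
  lookup-injective {x ∷ xs} (x∉ ∷ _) (suc i) zero e = contradiction (≈-sym e) (All.lookup x∉ (∈-lookup i))
  lookup-injective {x ∷ xs} (_ ∷ u) (suc i) (suc j) e = cong suc (lookup-injective u i j e)

  -- A choice of related entries is an injection of indices. Applied in both directions, this
  -- compares covers up to `≈` with descents up to equality.
  length-≤ : {B : Set} (R : Carrier → B → Set) {xs : List Carrier} (ys : List B) → Unique xs →
    (∀ i → ∃ λ k → R (lookup xs i) (lookup ys k)) →
    (∀ {x x′ y} → R x y → R x′ y → x ≈ x′) → length xs ≤ length ys
  length-≤ R {xs} ys u total inj = Finₚ.injective⇒≤ {f = proj₁ ∘ total} λ {i} {j} e →
    lookup-injective u i j (inj (proj₂ (total i))
      (subst (λ k → R (lookup xs j) (lookup ys k)) (sym e) (proj₂ (total j))))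

length-filter-tabulate : ∀ {n} {A : Set} {P : A → Set} (P? : Decidable P) (f : Fin n → A) →
  + length (filter P? (tabulate f)) ≡ ∑[ i < n ] ⟦ P? (f i) ⟧
length-filter-tabulate {zero} P? f = refl
length-filter-tabulate {suc n} P? f with P? (f zero)
... | yes _ = trans (ℤₚ.pos-+ 1 _) (cong (λ z → 1ℤ ℤ.+ z) (length-filter-tabulate P? (f ∘ suc)))
... | no _  = trans (length-filter-tabulate P? (f ∘ suc)) (sym (ℤₚ.+-identityˡ _))

length-filter-product : ∀ {m n} {A B : Set} {P : A × B → Set} (P? : Decidable P) (f : Fin m → A) (g : Fin n → B) →
  + length (filter P? (cartesianProduct (tabulate f) (tabulate g))) ≡ ∑[ i < m ] ∑[ j < n ] ⟦ P? (f i , g j) ⟧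
length-filter-product {zero} P? f g = refl
length-filter-product {suc m} {n} P? f g = begin
  + length (filter P? (map (f zero ,_) (tabulate g) ++ rest))
    ≡⟨ cong (+_ ∘ length) (Listₚ.filter-++ P? (map (f zero ,_) (tabulate g)) rest) ⟩
  + length (filter P? (map (f zero ,_) (tabulate g)) ++ filter P? rest)
    ≡⟨ trans (cong +_ (Listₚ.length-++ (filter P? (map (f zero ,_) (tabulate g))))) (ℤₚ.pos-+ (length (filter P? (map (f zero ,_) (tabulate g)))) _) ⟩
  + length (filter P? (map (f zero ,_) (tabulate g))) ℤ.+ + length (filter P? rest)
    ≡⟨ cong₂ ℤ._+_ (trans (cong (+_ ∘ length ∘ filter P?) (Listₚ.map-tabulate g (f zero ,_)))
                          (length-filter-tabulate P? (λ j → f zero , g j)))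
                   (length-filter-product P? (f ∘ suc) g) ⟩
  ∑[ i < suc m ] ∑[ j < n ] ⟦ P? (f i , g j) ⟧ ∎
  where
  open ≡-Reasoning
  rest = cartesianProduct (tabulate (f ∘ suc)) (tabulate g)

module _ {n : ℕ} (w : Permutation′ n) where
  open FinitePoset [e, w ] using (Carrier; poset; _≈_; _≟_; elements; complete; module Eq)
  open Order poset using (_⋖_)

  step-unique : ∀ {s t v : Permutation′ n} {x y} → Step s v x y → Step t v x y → s Perm.≈ t
  step-unique {s} {t} {v} {x} {y} st st′ = antisym {u = s} {v = t} (below s t st st′) (below t s st′ st)
    where
    below : ∀ s t → Step s v x y → Step t v x y → s ≤ʷ t
    below s t st st′ {c , d} q with Step.only st′ (Step.below st {c , d} q)
    ... | inj₁ r = r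
    ... | inj₂ (refl , refl) = contradiction q (Asc⇒¬Inv⁻¹ s (Step.asc st))

  step-pair-unique : ∀ {s v : Permutation′ n} {x y c d} → Step s v x y → Step s v c d → (x , y) ≡ (c , d)
  step-pair-unique {s} {v} st st′ with Step.only st′ (Desc⇒Inv⁻¹ v (Step.desc st))
  ... | inj₁ q = contradiction q (Asc⇒¬Inv⁻¹ s (Step.asc st))
  ... | inj₂ (refl , refl) = refl

  -- Undoing a descent gives a lower cover, and the cover and the exchanged pair determine each
  -- other.
  ddeg-descents : ∀ (v : Carrier) → + ddeg [e, w ] v ≡ ∑[ x < n ] ∑[ y < n ] ⟦ desc? w (proj₁ v) x y ⟧
  ddeg-descents v = trans (cong +_ (ℕₚ.≤-antisym
      (length-≤ Eq.setoid R descents covers! cover→descent step-unique)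
      (length-≤ (setoid (Fin n × Fin n)) (λ p s → R s p) covers descents! descent→cover step-pair-unique)))
    (length-filter-product isDesc? (λ i → i) (λ j → j))
    where
    R : Carrier → Fin n × Fin n → Set
    R s (x , y) = Step (proj₁ s) (proj₁ v) x y
    isDesc? : Decidable (λ ((x , y) : Fin n × Fin n) → Desc (proj₁ v) x y)
    isDesc? (x , y) = desc? w (proj₁ v) x y
    descents = filter isDesc? (cartesianProduct (allFin n) (allFin n))
    descents! = Uniqueₚ.filter⁺ isDesc? (Uniqueₚ.cartesianProduct⁺ (Uniqueₚ.allFin⁺ n) (Uniqueₚ.allFin⁺ n))
    isCover? = λ x → cover? [e, w ] x v
    covers = deduplicate _≟_ (filter isCover? elements)
    covers! = UniqueDecₚ.deduplicate-! (record { isDecEquivalence = Eq.isDecEquivalence }) (filter isCover? elements)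
    cover→descent : ∀ i → ∃ λ k → R (lookup covers i) (lookup descents k)
    cover→descent i =
      let ∈filter = Memₛ.∈-deduplicate⁻ (setoid Carrier) _≟_ (filter isCover? elements) (∈-lookup i)
          s⋖v     = proj₂ (∈-filter⁻ isCover? {xs = elements} ∈filter)
          x , y , st = cover⇒step w (lookup covers i) v s⋖v
          p∈      = ∈-filter⁺ isDesc? (∈-cartesianProduct⁺ (∈-allFin x) (∈-allFin y)) (Step.desc st)
      in Any.index p∈ , subst (R (lookup covers i)) (lookup-index p∈) st
    respects : (_⋖ v) Respects _≈_
    respects {s} {t} s≈t s⋖v =
      let _ , _ , st = cover⇒step w s v s⋖v
      in step⇒cover w t v (step-congˡ {s = proj₁ s} {u = proj₁ t} (Eq.sym {s} {t} s≈t) st)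
    descent→cover : ∀ k → ∃ λ i → R (lookup covers i) (lookup descents k)
    descent→cover k =
      let δ  = proj₂ (∈-filter⁻ isDesc? {xs = cartesianProduct (allFin n) (allFin n)} (∈-lookup k))
          st = step-down {z = proj₁ v} δ
          s  = member w (swap (proj₁ v) _ _) λ {p} → proj₂ (proj₂ v) {p} ∘ Step.below st {p}
          s∈ = Memₛ.∈-deduplicate⁺ Eq.setoid _≟_
                 (λ {x} {y} {z} z≈y x≈y → Eq.trans {x} {y} {z} x≈y (Eq.sym {z} {y} z≈y)) {z = s}
                 (Memₛ.∈-filter⁺ Eq.setoid isCover? (λ {s} {t} → respects {s} {t})
                   {v = s} (complete s) (step⇒cover w s v st))
      in Any.index s∈ , step-congˡ {s = proj₁ s} {u = proj₁ (lookup covers (Any.index s∈))}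
           (Eq.sym {s} {lookup covers (Any.index s∈)} (lookup-index s∈)) st

rational-sum : ∀ {A : Set} (f : A → ℕ) (xs : List A) →
  foldr ℚ._+_ 0ℚ (map (λ x → + f x ℚ./ 1) xs) ≡ + foldr ℕ._+_ 0 (map f xs) ℚ./ 1
rational-sum f [] = refl
rational-sum f (x ∷ xs) = trans (cong (λ z → + f x ℚ./ 1 ℚ.+ z) (rational-sum f xs)) (ℚₚ.toℚᵘ-injective (begin
  ℚ.toℚᵘ (+ f x ℚ./ 1 ℚ.+ + s ℚ./ 1)
    ≈⟨ ℚₚ.toℚᵘ-homo-+ (+ f x ℚ./ 1) (+ s ℚ./ 1) ⟩
  ℚ.toℚᵘ (+ f x ℚ./ 1) ℚᵘ.+ ℚ.toℚᵘ (+ s ℚ./ 1)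
    ≈⟨ ℚᵘₚ.+-cong (ℚₚ.toℚᵘ-fromℚᵘ (mkℚᵘ (+ f x) 0)) (ℚₚ.toℚᵘ-fromℚᵘ (mkℚᵘ (+ s) 0)) ⟩
  mkℚᵘ (+ f x) 0 ℚᵘ.+ mkℚᵘ (+ s) 0
    ≈⟨ *≡* (cong (ℤ._* 1ℤ) (trans (cong₂ ℤ._+_ (ℤₚ.*-identityʳ (+ f x)) (ℤₚ.*-identityʳ (+ s))) (sym (ℤₚ.pos-+ (f x) s)))) ⟩
  mkℚᵘ (+ (f x ℕ.+ s)) 0
    ≈⟨ ℚₚ.toℚᵘ-fromℚᵘ (mkℚᵘ (+ (f x ℕ.+ s)) 0) ⟨
  ℚ.toℚᵘ (+ (f x ℕ.+ s) ℚ./ 1) ∎))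
  where
  open ℚᵘₚ.≃-Reasoning
  s = foldr ℕ._+_ 0 (map f xs)

rational-average : ∀ t k m c .{{_ : NonZero k}} .{{_ : NonZero c}} → + c ℤ.* + t ≡ + k ℤ.* + m →
  (+ t ℚ./ 1) ℚ.* (1ℤ ℚ./ k) ≡ + m ℚ./ c
rational-average t (suc k) m (suc c) e = ℚₚ.toℚᵘ-injective (begin
  ℚ.toℚᵘ ((+ t ℚ./ 1) ℚ.* (1ℤ ℚ./ suc k))
    ≈⟨ ℚₚ.toℚᵘ-homo-* (+ t ℚ./ 1) (1ℤ ℚ./ suc k) ⟩
  ℚ.toℚᵘ (+ t ℚ./ 1) ℚᵘ.* ℚ.toℚᵘ (1ℤ ℚ./ suc k)
    ≈⟨ ℚᵘₚ.*-cong (ℚₚ.toℚᵘ-fromℚᵘ (mkℚᵘ (+ t) 0)) (ℚₚ.toℚᵘ-fromℚᵘ (mkℚᵘ 1ℤ k)) ⟩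
  mkℚᵘ (+ t) 0 ℚᵘ.* mkℚᵘ 1ℤ k
    ≈⟨ *≡* (alg (+ t) (+ suc c) (+ suc k) (+ m) (cong +_ (ℕₚ.+-identityʳ (suc k))) e) ⟩
  mkℚᵘ (+ m) c
    ≈⟨ ℚₚ.toℚᵘ-fromℚᵘ (mkℚᵘ (+ m) c) ⟨
  ℚ.toℚᵘ (+ m ℚ./ suc c) ∎)
  where
  open ℚᵘₚ.≃-Reasoning
  alg : ∀ t c k m {k′} → k′ ≡ k → c ℤ.* t ≡ k ℤ.* m → t ℤ.* 1ℤ ℤ.* c ≡ m ℤ.* k′
  alg t c k m refl e = trans (cong (ℤ._* c) (ℤₚ.*-identityʳ t))
    (trans (ℤₚ.*-comm t c) (trans e (ℤₚ.*-comm k m)))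

private
  step-alg : ∀ a d s c m → s ≡ a ℤ.- (d ℤ.- c ℤ.* m) → c ℤ.* m ≡ s ℤ.+ d ℤ.- a
  step-alg a d s c m refl = alg a d c m
    where
    alg : ∀ a d c m → c ℤ.* m ≡ (a ℤ.- (d ℤ.- c ℤ.* m)) ℤ.+ d ℤ.- a
    alg = solve-∀
  orbit-alg : ∀ m k a b d → (m ℤ.+ a ℤ.- b) ℤ.+ (k ℤ.* m ℤ.+ b ℤ.- d) ≡ (1ℤ ℤ.+ k) ℤ.* m ℤ.+ a ℤ.- d
  orbit-alg = solve-∀
  cancel-alg : ∀ x a → x ℤ.+ a ℤ.- a ≡ x
  cancel-alg = solve-∀
  weight-alg : ∀ d W c → d ℤ.* (W ℤ.- c) ≡ d ℤ.* W ℤ.- c ℤ.* d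
  weight-alg = solve-∀

module Homomesy {n : ℕ} (w : Permutation′ n) (R : Rowmotion (FinitePoset.poset [e, w ]))
  {m : ℕ} (X Y : Fin m → Fin n)
  (box  : ∀ τ → Δ w (X τ) (Y τ))
  (full : ∀ τ {l r} → Δ w l (Y τ) → Δ w (X τ) r → Δ w l r)
  (c : ℕ)
  (count : ∀ {x y} → Δ w x y →
           ∑[ τ < m ] (⟦ X τ Finₚ.≟ x ⟧ ℤ.+ ⟦ Y τ Finₚ.≟ y ⟧) ≡ + c)
  where
  open FinitePoset [e, w ] using (Carrier; _≈_; module Eq)
  open Rowmotion R using (row; row-def)
  open Weight w X Y box full

  row-fun : Carrier → Carrier
  row-fun = Inverse.to row

  down-weight : Permutation′ n → ℤ
  down-weight v = ∑[ x < n ] ∑[ y < n ] (⟦ desc? w v x y ⟧ ℤ.* weight v x y)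

  -- An orbit closes only up to pointwise equality, so the two ends of the telescoping sum have to
  -- be compared across it.
  down-weight-cong : ∀ {u v : Carrier} → u ≈ v → down-weight (proj₁ u) ≡ down-weight (proj₁ v)
  down-weight-cong {u , _} {v , _ , v≤w} u≈v = sum-cong-≗ {n} λ x → sum-cong-≗ {n} (term x)
    where
    desc-cong : ∀ {u v : Permutation′ n} → u Perm.≈ v → ∀ {x y} → Desc u x y → Desc v x y
    desc-cong {u} {v} u≈v {x} {y} (x<y , e) =
      x<y , subst₂ _⋯_ (pos-cong {u = u} {v = v} u≈v y) (pos-cong {u = u} {v = v} u≈v x) e
    term : ∀ x y → ⟦ desc? w u x y ⟧ ℤ.* weight u x y ≡ ⟦ desc? w v x y ⟧ ℤ.* weight v x y
    term x y with desc? w u x y | desc? w v x y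
    ... | no _   | no _  = refl
    ... | yes δ  | no ¬δ = contradiction (desc-cong {u} {v} u≈v δ) ¬δ
    ... | no ¬δ  | yes δ = contradiction (desc-cong {v} {u} (λ i → sym (u≈v i)) δ) ¬δ
    ... | yes δ  | yes ε = cong (1ℤ ℤ.*_)
      (weight-invariant {u} {v} (≈⇒≤ {u = u} {v = v} u≈v) v≤w (inj₂ (proj₂ δ)) (inj₂ (proj₂ ε)))

  asc-weight : Permutation′ n → ℤ
  asc-weight u = ∑[ x < n ] ∑[ y < n ] (⟦ asc? w u x y ⟧ ℤ.* weight u x y)

  -- The labels above `u` are the labels below its image. Hence the ascents of `u` in `Δ` and the
  -- descents of the image are the same pairs, and their weights agree by transfer.
  row-weight : ∀ u → asc-weight (proj₁ u) ≡ down-weight (proj₁ (row-fun u))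
  row-weight u = sum-cong-≗ {n} λ x → sum-cong-≗ {n} (term x)
    where
    v = row-fun u
    D≐U = Equivalence.to (row-def u v) (Eq.refl {v})
    term : ∀ x y → ⟦ asc? w (proj₁ u) x y ⟧ ℤ.* weight (proj₁ u) x y
                 ≡ ⟦ desc? w (proj₁ v) x y ⟧ ℤ.* weight (proj₁ v) x y
    term x y with asc? w (proj₁ u) x y | desc? w (proj₁ v) x y
    ... | no _        | no _  = refl
    ... | yes (a , p) | no ¬δ = contradiction (Transfer.desc (asc⇒transfer w u v D≐U a p)) ¬δ
    ... | no ¬a       | yes δ = contradiction
      (Step.asc (Transfer.step (desc⇒transfer w u v D≐U δ)) ,
       proj₂ (proj₂ v) (Desc⇒Inv⁻¹ (proj₁ v) δ)) ¬a
    ... | yes _       | yes δ = cong (1ℤ ℤ.*_)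
      (weight-transfer {proj₁ u} {proj₁ v} (proj₂ (proj₂ v)) (desc⇒transfer w u v D≐U δ))

  -- This is `balance` solved for the number of descents, with the ascent weights moved to the next
  -- element of the orbit so that the sum telescopes.
  ddeg-step : ∀ u → + c ℤ.* + ddeg [e, w ] u ≡ + m ℤ.+ down-weight (proj₁ u) ℤ.- down-weight (proj₁ (row-fun u))
  ddeg-step u = trans
    (step-alg (asc-weight (proj₁ u)) (down-weight (proj₁ u)) (+ m) (+ c) (+ ddeg [e, w ] u) (begin
      + m
        ≡⟨ Identity.balance {w = w} {u = proj₁ u} (λ {p} → proj₂ (proj₂ u) {p}) X Y box full (+ c) count ⟨
      asc-weight (proj₁ u) ℤ.- ∑[ x < n ] ∑[ y < n ] (d x y ℤ.* (weight (proj₁ u) x y ℤ.- + c))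
        ≡⟨ cong (λ z → asc-weight (proj₁ u) ℤ.- z) (trans
             (sum-cong-≗ {n} λ x → trans (sum-cong-≗ {n} λ y → weight-alg (d x y) (weight (proj₁ u) x y) (+ c))
               (∑-distrib-- (λ y → d x y ℤ.* weight (proj₁ u) x y) (λ y → + c ℤ.* d x y)))
             (trans (∑-distrib-- (λ x → ∑[ y < n ] (d x y ℤ.* weight (proj₁ u) x y)) (λ x → ∑[ y < n ] (+ c ℤ.* d x y)))
               (cong (λ z → down-weight (proj₁ u) ℤ.- z) (trans
                 (sum-cong-≗ {n} λ x → sym (*-distribˡ-sum (+ c) (d x)))
                 (sym (*-distribˡ-sum (+ c) (λ x → sum (d x)))))))) ⟩
      asc-weight (proj₁ u) ℤ.- (down-weight (proj₁ u) ℤ.- + c ℤ.* ∑[ x < n ] ∑[ y < n ] d x y)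
        ≡⟨ cong (λ z → asc-weight (proj₁ u) ℤ.- (down-weight (proj₁ u) ℤ.- + c ℤ.* z)) (ddeg-descents w u) ⟨
      asc-weight (proj₁ u) ℤ.- (down-weight (proj₁ u) ℤ.- + c ℤ.* + ddeg [e, w ] u) ∎))
    (cong (λ z → + m ℤ.+ down-weight (proj₁ u) ℤ.- z) (row-weight u))
    where
    open ≡-Reasoning
    d : Fin n → Fin n → ℤ
    d x y = ⟦ desc? w (proj₁ u) x y ⟧

  total-ddeg : Carrier → ℕ → ℕ
  total-ddeg u k = foldr ℕ._+_ 0 (map (ddeg [e, w ]) (iterate row-fun u k))

  ddeg-orbit : ∀ k u → + c ℤ.* + total-ddeg u k
    ≡ + k ℤ.* + m ℤ.+ down-weight (proj₁ u) ℤ.- down-weight (proj₁ (ℕ-Iterate.iterate row-fun u k))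
  ddeg-orbit zero u = trans (ℤₚ.*-zeroʳ (+ c)) (sym (trans
    (cong (λ z → z ℤ.- down-weight (proj₁ u)) (cong (λ z → z ℤ.+ down-weight (proj₁ u)) (ℤₚ.*-zeroˡ (+ m))))
    (cancel-alg 0ℤ (down-weight (proj₁ u)))))
  ddeg-orbit (suc k) u = begin
    + c ℤ.* + (ddeg [e, w ] u ℕ.+ total-ddeg (row-fun u) k)
      ≡⟨ trans (cong (+ c ℤ.*_) (ℤₚ.pos-+ (ddeg [e, w ] u) (total-ddeg (row-fun u) k)))
               (ℤₚ.*-distribˡ-+ (+ c) (+ ddeg [e, w ] u) (+ total-ddeg (row-fun u) k)) ⟩
    + c ℤ.* + ddeg [e, w ] u ℤ.+ + c ℤ.* + total-ddeg (row-fun u) k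
      ≡⟨ cong₂ ℤ._+_ (ddeg-step u) (ddeg-orbit k (row-fun u)) ⟩
    (+ m ℤ.+ a ℤ.- b) ℤ.+ (+ k ℤ.* + m ℤ.+ b ℤ.- d)
      ≡⟨ orbit-alg (+ m) (+ k) a b d ⟩
    + suc k ℤ.* + m ℤ.+ a ℤ.- d ∎
    where
    open ≡-Reasoning
    a = down-weight (proj₁ u)
    b = down-weight (proj₁ (row-fun u))
    d = down-weight (proj₁ (ℕ-Iterate.iterate row-fun (row-fun u) k))

  ddeg-mesic : .{{_ : NonZero c}} → Mesic Eq.setoid row (λ u → + ddeg [e, w ] u ℚ./ 1) (+ m ℚ./ c)
  ddeg-mesic u k (_ , returns , _) = trans
    (cong (ℚ._* (1ℤ ℚ./ k)) (rational-sum (ddeg [e, w ]) (iterate row-fun u k)))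
    (rational-average (total-ddeg u k) k m c (trans (ddeg-orbit k u)
      (trans (cong (λ z → + k ℤ.* + m ℤ.+ down-weight (proj₁ u) ℤ.- z)
               (down-weight-cong {ℕ-Iterate.iterate row-fun u k} {u} returns))
             (cancel-alg (+ k ℤ.* + m) (down-weight (proj₁ u))))))

-- Outward corners and the antidiagonal

part-decreasing : ∀ {xs} → Linked _≥_ xs → ∀ {i i′} → i ≤ i′ → part xs i′ ≤ part xs i
part-decreasing {[]} _ _ = z≤n
part-decreasing {x ∷ []} _ {zero}  {zero}   _ = ℕₚ.≤-refl
part-decreasing {x ∷ []} _ {zero}  {suc _}  _ = z≤n
part-decreasing {x ∷ []} _ {suc _} {suc _}  _ = z≤n
part-decreasing {x ∷ y ∷ xs} (x≥y ∷ l) {zero}  {zero}   _ = ℕₚ.≤-refl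
part-decreasing {x ∷ y ∷ xs} (x≥y ∷ l) {zero}  {suc i′} _ = ℕₚ.≤-trans (part-decreasing l {0} {i′} z≤n) x≥y
part-decreasing {x ∷ y ∷ xs} (x≥y ∷ l) {suc i} {suc i′} (s≤s p) = part-decreasing l p

first-failure : ∀ {P : ℕ → Set} → Decidable P → ∀ {i i′} → i ≤ i′ → P i → ¬ P i′ →
                ∃ λ t → i ≤ t × suc t ≤ i′ × P t × ¬ P (suc t)
first-failure {P} P? {i} {i′} i≤i′ Pi ¬Pi′ = go i′ i≤i′ ¬Pi′
  where
  go : ∀ i′ → i ≤ i′ → ¬ P i′ → ∃ λ t → i ≤ t × suc t ≤ i′ × P t × ¬ P (suc t)
  go i′ i≤i′ ¬P with ℕₚ.m≤n⇒m<n∨m≡n i≤i′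
  ... | inj₂ refl = contradiction Pi ¬P
  go (suc i′) _ ¬P | inj₁ (s≤s i≤i′) with P? i′
  ... | yes Pi′ = i′ , i≤i′ , ℕₚ.≤-refl , Pi′ , ¬P
  ... | no ¬P′  with go i′ i≤i′ ¬P′
  ...   | t , i≤t , t<i′ , Pt , ¬Pt = t , i≤t , ℕₚ.m≤n⇒m≤1+n t<i′ , Pt , ¬Pt

module Shape (σ : SkewShape) where
  open SkewShape σ

  -- Row `i` of the shape occupies the columns from `lo i` up to, but excluding, `hi i`.
  hi lo : ℕ → ℕ
  hi = part (Partition.parts outer)
  lo = part (Partition.parts inner)

  hi-decreasing : ∀ {i i′} → i ≤ i′ → hi i′ ≤ hi i
  hi-decreasing = part-decreasing (Partition.decreasing outer)

  lo-decreasing : ∀ {i i′} → i ≤ i′ → lo i′ ≤ lo i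
  lo-decreasing = part-decreasing (Partition.decreasing inner)

  box : ∀ {i j} → lo i ≤ j → j < hi i → (i , j) ∈ diagram
  box lo≤j j<hi = j<hi , ℕₚ.≤⇒≯ lo≤j

  lo≤ : ∀ {i j} → (i , j) ∈ diagram → lo i ≤ j
  lo≤ (_ , ¬j<lo) = ℕₚ.≮⇒≥ ¬j<lo

  <hi : ∀ {i j} → (i , j) ∈ diagram → j < hi i
  <hi = proj₁

  -- Covers are comparable pairs of boxes, so a property invariant under comparability travels along
  -- every path.
  connected-all : Connected diagram → (Q : Box → Set) →
    (∀ {x y} → x ∈ diagram → y ∈ diagram → proj₁ x ≤ proj₁ y → proj₂ x ≤ proj₂ y → (Q x → Q y) × (Q y → Q x)) →
    ∀ {x y} → x ∈ diagram → y ∈ diagram → Q x → Q y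
  connected-all (_ , path) Q step {x} {y} x∈ y∈ = proj₁ (fold ∼-isEquivalence
    (λ { {_ , p} {_ , q} (((r≤ , c≤) , _) , _) → step p q r≤ c≤ }) (path (x , x∈) (y , y∈)))
    where
    ∼-isEquivalence : IsEquivalence {A = Σ Box diagram}
      (λ x y → (Q (proj₁ x) → Q (proj₁ y)) × (Q (proj₁ y) → Q (proj₁ x)))
    ∼-isEquivalence = record
      { refl  = (λ q → q) , (λ q → q)
      ; sym   = λ (f , g) → g , f
      ; trans = λ (f , g) (f′ , g′) → f′ ∘ f , g ∘ g′
      }

  module Bounded (connected : Connected diagram) {r c a b : ℕ} (bounding : IsBoundingBox diagram r c a b) where

    row≥ : ∀ {i j} → (i , j) ∈ diagram → r ≤ i
    row≥ = proj₁ ∘ proj₁ ∘ proj₁ bounding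
    row< : ∀ {i j} → (i , j) ∈ diagram → i < r + a
    row< = proj₂ ∘ proj₁ ∘ proj₁ bounding
    col≥ : ∀ {i j} → (i , j) ∈ diagram → c ≤ j
    col≥ = proj₁ ∘ proj₂ ∘ proj₁ bounding
    col< : ∀ {i j} → (i , j) ∈ diagram → j < c + b
    col< = proj₂ ∘ proj₂ ∘ proj₁ bounding

    private
      shorter : ∀ {r a t} → r ≤ t → t < r + a → ¬ (a ≤ t ∸ r)
      shorter {r} {a} {t} r≤t t<r+a a≤ = ℕₚ.<⇒≱ t<r+a (subst (_≤ t) (ℕₚ.+-comm a r)
        (ℕₚ.≤-trans (ℕₚ.+-monoˡ-≤ r a≤) (ℕₚ.≤-reflexive (ℕₚ.m∸n+n≡m r≤t))))

      cut-off : ∀ {r a t} → r ≤ t → t < r + a → ¬ (a ≤ (r + a) ∸ suc t)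
      cut-off {r} {a} {t} r≤t t<r+a a≤ = ℕₚ.<⇒≱ (s≤s r≤t) (ℕₚ.+-cancelʳ-≤ a (suc t) r (begin
        suc t + a                   ≤⟨ ℕₚ.+-monoʳ-≤ (suc t) a≤ ⟩
        suc t + ((r + a) ∸ suc t)   ≡⟨ ℕₚ.m+[n∸m]≡n t<r+a ⟩
        r + a                       ∎))
        where open ℕₚ.≤-Reasoning

    -- Otherwise the rectangle could be trimmed at row `t`, against its minimality. The next three
    -- lemmas trim the other sides.
    rows-below : ∀ {t} → r ≤ t → t < r + a → ¬ (∀ {i j} → (i , j) ∈ diagram → i < t)
    rows-below {t} r≤t t<r+a all = shorter r≤t t<r+a (proj₁ (proj₂ bounding r c (t ∸ r) b λ x →
      (row≥ x , ℕₚ.<-≤-trans (all x) (ℕₚ.≤-reflexive (sym (ℕₚ.m+[n∸m]≡n (ℕₚ.≤-trans (row≥ x) (ℕₚ.<⇒≤ (all x))))))) ,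
      (col≥ x , col< x)))

    rows-above : ∀ {t} → r ≤ t → t < r + a → ¬ (∀ {i j} → (i , j) ∈ diagram → t < i)
    rows-above {t} r≤t t<r+a all = cut-off r≤t t<r+a (proj₁ (proj₂ bounding (suc t) c ((r + a) ∸ suc t) b λ x →
      (all x , ℕₚ.<-≤-trans (row< x) (ℕₚ.≤-reflexive (sym (ℕₚ.m+[n∸m]≡n t<r+a)))) , (col≥ x , col< x)))

    cols-left : ∀ {t} → c ≤ t → t < c + b → ¬ (∀ {i j} → (i , j) ∈ diagram → j < t)
    cols-left {t} c≤t t<c+b all = shorter c≤t t<c+b (proj₂ (proj₂ bounding r c a (t ∸ c) λ x →
      (row≥ x , row< x) ,
      (col≥ x , ℕₚ.<-≤-trans (all x) (ℕₚ.≤-reflexive (sym (ℕₚ.m+[n∸m]≡n (ℕₚ.≤-trans (col≥ x) (ℕₚ.<⇒≤ (all x)))))))))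

    cols-right : ∀ {t} → c ≤ t → t < c + b → ¬ (∀ {i j} → (i , j) ∈ diagram → t < j)
    cols-right {t} c≤t t<c+b all = cut-off c≤t t<c+b (proj₂ (proj₂ bounding r (suc t) a ((c + b) ∸ suc t) λ x →
      (row≥ x , row< x) , (all x , ℕₚ.<-≤-trans (col< x) (ℕₚ.≤-reflexive (sym (ℕₚ.m+[n∸m]≡n t<c+b))))))

    -- For t′ = t this says that row t is not empty, for t′ = t + 1 that rows t and t + 1 share a column.
    rows-overlap : ∀ {t t′} → r ≤ t → t ≤ t′ → t′ ≤ suc t → t′ < r + a → lo t < hi t′
    rows-overlap {t} {t′} r≤t t≤t′ t′≤1+t t′<r+a with lo t ℕ.<? hi t′
    ... | yes p = p
    ... | no ¬p = ⊥-elim (byBase (proj₁ connected))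
      where
      -- Without the overlap, no comparability leads from the rows up to `t` to the rows from `t′`
      -- on, so these rows would be disconnected.
      gap : ∀ {i j i′ j′} → (i , j) ∈ diagram → (i′ , j′) ∈ diagram → i ≤ t → t′ ≤ i′ → ¬ (j ≤ j′)
      gap {i} {j} {i′} {j′} x y i≤t t′≤i′ j≤j′ = ¬p (begin-strict
        lo t   ≤⟨ lo-decreasing i≤t ⟩
        lo i   ≤⟨ lo≤ x ⟩
        j      ≤⟨ j≤j′ ⟩
        j′     <⟨ <hi y ⟩
        hi i′  ≤⟨ hi-decreasing t′≤i′ ⟩
        hi t′  ∎)
        where open ℕₚ.≤-Reasoning
      same-side : ∀ {x y} → x ∈ diagram → y ∈ diagram → proj₁ x ≤ proj₁ y → proj₂ x ≤ proj₂ y →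
                  (proj₁ x ≤ t → proj₁ y ≤ t) × (proj₁ y ≤ t → proj₁ x ≤ t)
      same-side x y r≤ c≤ =
        (λ i≤t → ℕₚ.≮⇒≥ λ t<i′ → gap x y i≤t (ℕₚ.≤-trans t′≤1+t t<i′) c≤) , ℕₚ.≤-trans r≤
      byBase : (∃ λ x → x ∈ diagram) → ⊥
      byBase ((i , j) , x) with i ℕ.≤? t
      ... | yes i≤t = rows-below (ℕₚ.≤-trans r≤t t≤t′) t′<r+a λ {i′} {j′} y → ℕₚ.≰⇒> λ t′≤i′ →
              gap y y (connected-all connected (λ z → proj₁ z ≤ t) same-side x y i≤t) t′≤i′ ℕₚ.≤-refl
      ... | no i≰t = rows-above r≤t (ℕₚ.≤-<-trans t≤t′ t′<r+a) λ y → ℕₚ.≰⇒> λ i′≤t →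
              i≰t (connected-all connected (λ z → proj₁ z ≤ t) same-side y x i′≤t)

    -- Comparable boxes on either side of column `j` force a box of that column into the row of the
    -- upper one. An empty column would therefore separate the shape.
    column-nonempty : ∀ {j} → c ≤ j → j < c + b → ¬ (∀ i → ¬ ((i , j) ∈ diagram))
    column-nonempty {j} c≤j j<c+b empty = byBase (proj₁ connected)
      where
      off : ∀ {i k} → (i , k) ∈ diagram → k ≤ j → k < j
      off {i} x k≤j = ℕₚ.≤∧≢⇒< k≤j λ { refl → empty i x }
      same-side : ∀ {x y} → x ∈ diagram → y ∈ diagram → proj₁ x ≤ proj₁ y → proj₂ x ≤ proj₂ y →
                  (proj₂ x ≤ j → proj₂ y ≤ j) × (proj₂ y ≤ j → proj₂ x ≤ j)
      same-side {i , _} x y r≤ c≤ =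
        (λ k≤j → ℕₚ.≮⇒≥ λ j<k′ → empty i (box (ℕₚ.≤-trans (lo≤ x) k≤j)
          (ℕₚ.<-≤-trans (ℕₚ.<-trans j<k′ (<hi y)) (hi-decreasing r≤)))) , ℕₚ.≤-trans c≤
      byBase : (∃ λ x → x ∈ diagram) → ⊥
      byBase ((i , k) , x) with k ℕ.≤? j
      ... | yes k≤j = cols-left c≤j j<c+b λ y → off y
              (connected-all connected (λ z → proj₂ z ≤ j) same-side x y k≤j)
      ... | no k≰j = cols-right c≤j j<c+b λ y → ℕₚ.≰⇒> λ k′≤j →
              k≰j (connected-all connected (λ z → proj₂ z ≤ j) same-side y x k′≤j)

    private
      accept = λ {x} {xs} → Listₚ.filter-accept diagram? {x} {xs}
      reject = λ {x} {xs} → Listₚ.filter-reject diagram? {x} {xs}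

    -- The northwest box is missing, and the column shared by rows `t` and `t + 1` supplies the
    -- other three. The southwest box is returned in order to bound `j` by the rectangle. In
    -- `corner-hi` the southeast box is the missing one.
    corner-lo : ∀ {t j} → r ≤ t → suc t < r + a → suc j ≡ lo t → lo (suc t) ≤ j →
                OutwardCorner σ t j × (suc t , j) ∈ diagram
    corner-lo {t} {j} r≤t 1+t<r+a 1+j≡lo lo′≤j = count , sw
      where
      shared : suc j < hi (suc t)
      shared = subst (_< hi (suc t)) (sym 1+j≡lo) (rows-overlap r≤t (ℕₚ.n≤1+n t) ℕₚ.≤-refl 1+t<r+a)
      ne : (t , suc j) ∈ diagram
      ne = box (ℕₚ.≤-reflexive (sym 1+j≡lo)) (ℕₚ.<-≤-trans shared (hi-decreasing (ℕₚ.n≤1+n t)))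
      sw : (suc t , j) ∈ diagram
      sw = box lo′≤j (ℕₚ.<-trans (ℕₚ.n<1+n j) shared)
      se : (suc t , suc j) ∈ diagram
      se = box (ℕₚ.m≤n⇒m≤1+n lo′≤j) shared
      count : OutwardCorner σ t j
      count rewrite reject {t , j} {(t , suc j) ∷ (suc t , j) ∷ (suc t , suc j) ∷ []}
                      (λ nw → proj₂ nw (ℕₚ.≤-reflexive 1+j≡lo))
                  | accept {xs = (suc t , j) ∷ (suc t , suc j) ∷ []} ne
                  | accept {xs = (suc t , suc j) ∷ []} sw
                  | accept {xs = []} se = refl

    corner-hi : ∀ {t j} → r ≤ t → suc t < r + a → suc j ≡ hi (suc t) → suc j < hi t →
                OutwardCorner σ t j × (suc t , j) ∈ diagram
    corner-hi {t} {j} r≤t 1+t<r+a 1+j≡hi 1+j<hi = count , sw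
      where
      lo≤j : lo t ≤ j
      lo≤j = ℕ.s≤s⁻¹ (subst (suc (lo t) ≤_) (sym 1+j≡hi) (rows-overlap r≤t (ℕₚ.n≤1+n t) ℕₚ.≤-refl 1+t<r+a))
      nw : (t , j) ∈ diagram
      nw = box lo≤j (ℕₚ.<-trans (ℕₚ.n<1+n j) 1+j<hi)
      ne : (t , suc j) ∈ diagram
      ne = box (ℕₚ.m≤n⇒m≤1+n lo≤j) 1+j<hi
      sw : (suc t , j) ∈ diagram
      sw = box (ℕₚ.≤-trans (lo-decreasing (ℕₚ.n≤1+n t)) lo≤j) (ℕₚ.≤-reflexive 1+j≡hi)
      count : OutwardCorner σ t j
      count rewrite accept {xs = (t , suc j) ∷ (suc t , j) ∷ (suc t , suc j) ∷ []} nw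
                  | accept {xs = (suc t , j) ∷ (suc t , suc j) ∷ []} ne
                  | accept {xs = (suc t , suc j) ∷ []} sw
                  | reject {suc t , suc j} {[]} (λ se → ℕₚ.<-irrefl 1+j≡hi (<hi se)) = refl

    -- The two inequalities put the northwest vertex of box `(p , q)` strictly before the
    -- antidiagonal and its southeast vertex strictly beyond it.
    module Antidiagonal
      (balanced : ∀ p q → OutwardCorner σ (r + p) (c + q) → suc p * b + suc q * a ≡ a * b)
      {p q : ℕ} (p<a : p < a) (q<b : q < b)
      (above : p * b + q * a < a * b) (below : a * b < suc p * b + suc q * a)
      where

      I J : ℕ
      I = r + p
      J = c + q

      private
        I<r+a : I < r + a
        I<r+a = ℕₚ.+-monoʳ-< r p<a
        r≤I : r ≤ I
        r≤I = ℕₚ.m≤m+n r p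

        -- The corner is the point `(t + 1 , j + 1)`. It is weakly southeast of the southeast vertex
        -- of the box in the first case and weakly northwest of the northwest vertex in the second,
        -- hence off the antidiagonal.
        no-corner : ∀ {t j} → r ≤ t → c ≤ j → OutwardCorner σ t j → ¬ (I ≤ t × J ≤ j ⊎ t < I × j < J)
        no-corner {t} {j} r≤t c≤j corner with ℕₚ.m≤n⇒∃[o]m+o≡n r≤t | ℕₚ.m≤n⇒∃[o]m+o≡n c≤j
        ... | p′ , refl | q′ , refl = λ
          { (inj₁ (I≤ , J≤)) → ℕₚ.<⇒≱ below (ℕₚ.≤-trans
              (ℕₚ.+-mono-≤ (ℕₚ.*-monoˡ-≤ b (s≤s (ℕₚ.+-cancelˡ-≤ r p p′ I≤)))
                           (ℕₚ.*-monoˡ-≤ a (s≤s (ℕₚ.+-cancelˡ-≤ c q q′ J≤))))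
              (ℕₚ.≤-reflexive (balanced p′ q′ corner)))
          ; (inj₂ (<I , <J)) → ℕₚ.<⇒≱ above (ℕₚ.≤-trans
              (ℕₚ.≤-reflexive (sym (balanced p′ q′ corner)))
              (ℕₚ.+-mono-≤ (ℕₚ.*-monoˡ-≤ b (ℕₚ.+-cancelˡ-< r p′ p <I))
                           (ℕₚ.*-monoˡ-≤ a (ℕₚ.+-cancelˡ-< c q′ q <J)))) }

        -- Column `k` witnesses a drop of `lo`, which makes an outward corner at column `lo t - 1`.
        -- For a drop of `hi` the corner is at column `hi (suc t) - 1`.
        no-lo-corner : ∀ {t k} → r ≤ t → suc t < r + a → lo (suc t) ≤ k → k < lo t →
                       ¬ (I ≤ t × J ≤ k ⊎ t < I × lo t ≤ J)
        no-lo-corner {t} {k} r≤t 1+t<r+a lo′≤k k<lo h with lo t in eq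
        no-lo-corner {t} {k} r≤t 1+t<r+a lo′≤k (s≤s k≤j) h | suc j =
          let corner , x = corner-lo r≤t 1+t<r+a (sym eq) (ℕₚ.≤-trans lo′≤k k≤j)
          in no-corner r≤t (col≥ x) corner (weaken h)
          where
          weaken : I ≤ t × J ≤ k ⊎ t < I × suc j ≤ J → I ≤ t × J ≤ j ⊎ t < I × j < J
          weaken (inj₁ (i , e)) = inj₁ (i , ℕₚ.≤-trans e k≤j)
          weaken (inj₂ e) = inj₂ e

        no-hi-corner : ∀ {t k} → r ≤ t → suc t < r + a → hi (suc t) ≤ k → k < hi t →
                       ¬ (I ≤ t × J < hi (suc t) ⊎ t < I × k ≤ J)
        no-hi-corner {t} {k} r≤t 1+t<r+a hi′≤k k<hi h with hi (suc t) in eq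
        ... | zero  = ℕₚ.n≮0 (subst (lo t <_) eq (rows-overlap r≤t (ℕₚ.n≤1+n t) ℕₚ.≤-refl 1+t<r+a))
        ... | suc j =
          let corner , x = corner-hi r≤t 1+t<r+a (sym eq) (ℕₚ.≤-<-trans hi′≤k k<hi)
          in no-corner r≤t (col≥ x) corner (weaken h)
          where
          weaken : I ≤ t × J < suc j ⊎ t < I × k ≤ J → I ≤ t × J ≤ j ⊎ t < I × j < J
          weaken (inj₁ (i , e)) = inj₁ (i , ℕ.s≤s⁻¹ e)
          weaken (inj₂ (i , e)) = inj₂ (i , ℕₚ.≤-trans hi′≤k e)

        decreasing⇒< : ∀ {f : ℕ → ℕ} → (∀ {i i′} → i ≤ i′ → f i′ ≤ f i) → ∀ {i i′} → f i′ < f i → i < i′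
        decreasing⇒< dec p = ℕₚ.≰⇒> λ i′≤i → ℕₚ.<⇒≱ p (dec i′≤i)

      -- Column `J` has a box somewhere. If `J < lo I`, that box lies below row `I` and `lo` drops
      -- across `J` on the way to it. If `hi I ≤ J`, it lies above and `hi` drops across `J` on the
      -- way down. Both drops make forbidden corners.
      antidiagonal-box : (I , J) ∈ diagram
      antidiagonal-box with lo I ℕ.≤? J | J ℕ.<? hi I
      ... | yes p | yes q = box p q
      ... | no lo≰J | _ = contradiction
        (λ i x →
          let I<i = decreasing⇒< {lo} lo-decreasing (ℕₚ.≤-<-trans (lo≤ x) (ℕₚ.≰⇒> lo≰J))
              t , I≤t , t<i , J<lo , J≮lo = first-failure (λ t → J ℕ.<? lo t) (ℕₚ.<⇒≤ I<i)
                (ℕₚ.≰⇒> lo≰J) (ℕₚ.≤⇒≯ (lo≤ x))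
          in no-lo-corner (ℕₚ.≤-trans r≤I I≤t) (ℕₚ.≤-<-trans t<i (row< x)) (ℕₚ.≮⇒≥ J≮lo) J<lo
               (inj₁ (I≤t , ℕₚ.≤-refl)))
        (column-nonempty (ℕₚ.m≤m+n c q) (ℕₚ.+-monoʳ-< c q<b))
      ... | _ | no J≮hi = contradiction
        (λ i x →
          let i<I = decreasing⇒< {hi} hi-decreasing (ℕₚ.≤-<-trans (ℕₚ.≮⇒≥ J≮hi) (<hi x))
              t , i≤t , t<I , J<hi , J≮hi′ = first-failure (λ t → J ℕ.<? hi t) (ℕₚ.<⇒≤ i<I) (<hi x) J≮hi
          in no-hi-corner (ℕₚ.≤-trans (row≥ x) i≤t) (ℕₚ.≤-<-trans t<I I<r+a) (ℕₚ.≮⇒≥ J≮hi′) J<hi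
               (inj₂ (t<I , ℕₚ.≤-refl)))
        (column-nonempty (ℕₚ.m≤m+n c q) (ℕₚ.+-monoʳ-< c q<b))

      -- If `j < lo i`, then row `i` is above row `I` and `lo` drops across `j` between them,
      -- northwest of the box. If `hi i ≤ j`, then row `i` is below and `hi` drops across `j`,
      -- southeast of the box.
      antidiagonal-full : ∀ {i j} → (I , j) ∈ diagram → (i , J) ∈ diagram → (i , j) ∈ diagram
      antidiagonal-full {i} {j} x y with lo i ℕ.≤? j | j ℕ.<? hi i
      ... | yes p | yes q = box p q
      ... | no lo≰j | _ = ⊥-elim
        (let i<I = decreasing⇒< {lo} lo-decreasing (ℕₚ.≤-<-trans (lo≤ x) (ℕₚ.≰⇒> lo≰j))
             t , i≤t , t<I , j<lo , j≮lo = first-failure (λ t → j ℕ.<? lo t) (ℕₚ.<⇒≤ i<I)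
               (ℕₚ.≰⇒> lo≰j) (ℕₚ.≤⇒≯ (lo≤ x))
         in no-lo-corner (ℕₚ.≤-trans (row≥ y) i≤t) (ℕₚ.≤-<-trans t<I I<r+a) (ℕₚ.≮⇒≥ j≮lo) j<lo
              (inj₂ (t<I , ℕₚ.≤-trans (lo-decreasing i≤t) (lo≤ y))))
      ... | _ | no j≮hi = ⊥-elim
        (let I<i = decreasing⇒< {hi} hi-decreasing (ℕₚ.≤-<-trans (ℕₚ.≮⇒≥ j≮hi) (<hi x))
             t , I≤t , t<i , j<hi , j≮hi′ = first-failure (λ t → j ℕ.<? hi t) (ℕₚ.<⇒≤ I<i) (<hi x) j≮hi
         in no-hi-corner (ℕₚ.≤-trans r≤I I≤t) (ℕₚ.≤-<-trans t<i (row< y)) (ℕₚ.≮⇒≥ j≮hi′) j<hi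
              (inj₁ (I≤t , ℕₚ.<-≤-trans (<hi y) (hi-decreasing t<i))))

-- From the shape to the permutation

module Antidiagonal (a b : ℕ) where

  -- τ numbers ab steps of equal length on the main antidiagonal, from its northeast end.  Row i contains
  -- the steps from i b to (i + 1) b − 1 and column j those from (b − 1 − j) a to (b − j) a − 1.
  rowOf : Fin (a * b) → Fin a
  rowOf = Fin.quotient b

  colOf : Fin (a * b) → Fin b
  colOf τ = Fin.opposite (Fin.quotient a (Fin.cast (ℕₚ.*-comm a b) τ))

  quotient-bounds : ∀ {m} n (k : Fin (m * n)) →
    n * toℕ (Fin.quotient {m} n k) ≤ toℕ k × toℕ k < n * suc (toℕ (Fin.quotient {m} n k))
  quotient-bounds {m} n k =
    subst (n * toℕ i ≤_) (sym eq) (ℕₚ.m≤m+n _ _) ,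
    subst₂ _<_ (sym eq) (trans (ℕₚ.+-comm (n * toℕ i) n) (sym (ℕₚ.*-suc n (toℕ i))))
      (ℕₚ.+-monoʳ-< (n * toℕ i) (Finₚ.toℕ<n j))
    where
    i = Fin.quotient {m} n k
    j = proj₂ (Fin.remQuot {m} n k)
    eq : toℕ k ≡ n * toℕ i + toℕ j
    eq = trans (cong toℕ (sym (Finₚ.combine-remQuot {m} n k))) (Finₚ.toℕ-combine i j)

  opposite-+ : ∀ {n} (i : Fin n) → suc (toℕ (Fin.opposite i)) + toℕ i ≡ n
  opposite-+ {n} i = trans (cong (λ z → suc z + toℕ i) (Finₚ.opposite-prop i))
    (trans (sym (ℕₚ.+-suc (n ∸ suc (toℕ i)) (toℕ i))) (ℕₚ.m∸n+n≡m (Finₚ.toℕ<n i)))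

  private
    complement : ∀ a {q e b} → suc q + e ≡ b → a * b ≡ a * suc e + q * a
    complement a {q} {e} refl = trans (cong (a *_) (trans (sym (ℕₚ.+-suc q e)) (ℕₚ.+-comm q (suc e))))
      (trans (ℕₚ.*-distribˡ-+ a (suc e) q) (cong (λ z → a * suc e + z) (ℕₚ.*-comm a q)))
    complement′ : ∀ a {q e b} → suc q + e ≡ b → a * b ≡ a * e + suc q * a
    complement′ a {q} {e} refl = trans (cong (a *_) (ℕₚ.+-comm (suc q) e))
      (trans (ℕₚ.*-distribˡ-+ a e (suc q)) (cong (λ z → a * e + z) (ℕₚ.*-comm a (suc q))))

  module _ (τ : Fin (a * b)) where
    private
      e = Fin.quotient {b} a (Fin.cast (ℕₚ.*-comm a b) τ)
      p = toℕ (rowOf τ)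
      q = toℕ (colOf τ)
      bounds = quotient-bounds {b} a (Fin.cast (ℕₚ.*-comm a b) τ)
      toℕ-τ = Finₚ.toℕ-cast (ℕₚ.*-comm a b) τ

    -- The first step of row `p` is not after `τ`, and the last step of column `q` is not before it.
    -- For `southeast` the other ends of the two intervals are compared.
    northwest : p * b + q * a < a * b
    northwest = begin-strict
      p * b + q * a        ≡⟨ cong (λ z → z + q * a) (ℕₚ.*-comm p b) ⟩
      b * p + q * a        ≤⟨ ℕₚ.+-monoˡ-≤ (q * a) (proj₁ (quotient-bounds {a} b τ)) ⟩
      toℕ τ + q * a        ≡⟨ cong (λ z → z + q * a) toℕ-τ ⟨
      toℕ (Fin.cast (ℕₚ.*-comm a b) τ) + q * a <⟨ ℕₚ.+-monoˡ-< (q * a) (proj₂ bounds) ⟩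
      a * suc (toℕ e) + q * a ≡⟨ complement a (opposite-+ e) ⟨
      a * b ∎
      where open ℕₚ.≤-Reasoning

    southeast : a * b < suc p * b + suc q * a
    southeast = begin-strict
      a * b                    ≡⟨ complement′ a (opposite-+ e) ⟩
      a * toℕ e + suc q * a    ≤⟨ ℕₚ.+-monoˡ-≤ (suc q * a) (proj₁ bounds) ⟩
      toℕ (Fin.cast (ℕₚ.*-comm a b) τ) + suc q * a ≡⟨ cong (λ z → z + suc q * a) toℕ-τ ⟩
      toℕ τ + suc q * a        <⟨ ℕₚ.+-monoˡ-< (suc q * a) (proj₂ (quotient-bounds {a} b τ)) ⟩
      b * suc p + suc q * a    ≡⟨ cong (λ z → z + suc q * a) (ℕₚ.*-comm b (suc p)) ⟩
      suc p * b + suc q * a    ∎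
      where open ℕₚ.≤-Reasoning

  ∑-rowOf : ∀ i → ∑[ τ < a * b ] ⟦ rowOf τ Finₚ.≟ i ⟧ ≡ + b
  ∑-rowOf = ∑-quotient b

  ∑-colOf : ∀ j → ∑[ τ < a * b ] ⟦ colOf τ Finₚ.≟ j ⟧ ≡ + a
  ∑-colOf j = begin
    ∑[ τ < a * b ] ⟦ colOf τ Finₚ.≟ j ⟧
      ≡⟨ sum-permute (λ k → ⟦ Fin.opposite (Fin.quotient {b} a k) Finₚ.≟ j ⟧) (Perm.cast-id (ℕₚ.*-comm a b)) ⟨
    ∑[ k < b * a ] ⟦ Fin.opposite (Fin.quotient {b} a k) Finₚ.≟ j ⟧
      ≡⟨ sum-cong-≗ {b * a} (λ k → ⟦⟧-cong (_ Finₚ.≟ _) (Fin.quotient {b} a k Finₚ.≟ Fin.opposite j)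
           (λ e → trans (sym (Finₚ.opposite-involutive _)) (cong Fin.opposite e))
           (λ e → trans (cong Fin.opposite e) (Finₚ.opposite-involutive j))) ⟩
    ∑[ k < b * a ] ⟦ Fin.quotient {b} a k Finₚ.≟ Fin.opposite j ⟧
      ≡⟨ ∑-quotient a (Fin.opposite j) ⟩
    + a ∎
    where open ≡-Reasoning

module SkewVexillaryData
  (σ : SkewShape) {a b : ℕ} (size : HasHeightAndWidth (SkewShape.diagram σ) a b) (balanced : Balanced σ)
  {n : ℕ} (w : Permutation′ n) (vexillary : SkewVexillary w σ)
  where
  open SkewShape σ using (diagram)
  open Antidiagonal a b

  r c : ℕ
  r = proj₁ size
  c = proj₁ (proj₂ size)
  bounding : IsBoundingBox diagram r c a b
  bounding = proj₂ (proj₂ size)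

  open Shape σ using (module Bounded)
  open Bounded (proj₁ balanced) bounding using (row≥; row<; col≥; col<)
  module Diag (τ : Fin (a * b)) = Bounded.Antidiagonal (proj₁ balanced) bounding
    (proj₂ balanced r c a b bounding)
    {p = toℕ (rowOf τ)} {q = toℕ (colOf τ)} (Finₚ.toℕ<n (rowOf τ)) (Finₚ.toℕ<n (colOf τ))
    (northwest τ) (southeast τ)

  ρ = proj₁ vexillary
  κ = proj₁ (proj₂ vexillary)
  rothe = proj₂ (proj₂ vexillary)

  -- The Rothe box of an inverted pair `x < y` lies in the row of the place of `y` and in the column
  -- of `x`. These are its coordinates after rows and columns are permuted.
  row col : Fin n → ℕ
  row y = Inverse.to ρ (toℕ (pos w y))
  col x = Inverse.to κ (toℕ x)

  row-injective : ∀ {y y′} → row y ≡ row y′ → y ≡ y′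
  row-injective e = pos-injective w (Finₚ.toℕ-injective (Injection.injective (↔⇒↣ ρ) e))

  col-injective : ∀ {x x′} → col x ≡ col x′ → x ≡ x′
  col-injective e = Finₚ.toℕ-injective (Injection.injective (↔⇒↣ κ) e)

  Δ⇒diagram : ∀ {x y} → Δ w x y → (row y , col x) ∈ diagram
  Δ⇒diagram {x} {y} (x<y , y≺x) = Equivalence.to (rothe (toℕ (pos w y)) (toℕ x))
    (pos w y , pos w x , (y≺x , subst₂ Fin._<_ (sym (inverseʳ w)) (sym (inverseʳ w)) x<y) ,
     refl , cong toℕ (sym (inverseʳ w)))

  diagram⇒Δ : ∀ {x y} → (row y , col x) ∈ diagram → Δ w x y
  diagram⇒Δ {x} {y} d with Equivalence.from (rothe (toℕ (pos w y)) (toℕ x)) d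
  ... | i , j , (i<j , wj<wi) , y≡i , x≡wj with Finₚ.toℕ-injective y≡i | Finₚ.toℕ-injective x≡wj
  ...   | refl | refl =
    subst (w ⟨$⟩ʳ j Fin.<_) (inverseʳ w) wj<wi ,
    subst (pos w y Fin.<_) (sym (inverseˡ w)) i<j

  -- `ρ` and `κ` permute all natural numbers. The row and the column pulled back from the shape
  -- belong to letters because the box pulled back lies in the Rothe diagram.
  antidiagonal-letters : ∀ τ → ∃₂ λ x y → row y ≡ r + toℕ (rowOf τ) × col x ≡ c + toℕ (colOf τ)
  antidiagonal-letters τ
    with Equivalence.from (rothe (Inverse.from ρ (r + toℕ (rowOf τ))) (Inverse.from κ (c + toℕ (colOf τ))))
           (subst₂ (λ i j → (i , j) ∈ diagram) (sym (Inverse.strictlyInverseˡ ρ _)) (sym (Inverse.strictlyInverseˡ κ _))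
             (Diag.antidiagonal-box τ))
  ... | i , j , _ , ρ≡ , κ≡ = w ⟨$⟩ʳ j , w ⟨$⟩ʳ i ,
    trans (cong (Inverse.to ρ) (trans (cong toℕ (inverseˡ w)) (sym ρ≡))) (Inverse.strictlyInverseˡ ρ _) ,
    trans (cong (Inverse.to κ) (sym κ≡)) (Inverse.strictlyInverseˡ κ _)

  X Y : Fin (a * b) → Fin n
  X τ = proj₁ (antidiagonal-letters τ)
  Y τ = proj₁ (proj₂ (antidiagonal-letters τ))

  row-Y : ∀ τ → row (Y τ) ≡ r + toℕ (rowOf τ)
  row-Y τ = proj₁ (proj₂ (proj₂ (antidiagonal-letters τ)))

  col-X : ∀ τ → col (X τ) ≡ c + toℕ (colOf τ)
  col-X τ = proj₂ (proj₂ (proj₂ (antidiagonal-letters τ)))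

  box : ∀ τ → Δ w (X τ) (Y τ)
  box τ = diagram⇒Δ (subst₂ (λ i j → (i , j) ∈ diagram) (sym (row-Y τ)) (sym (col-X τ)) (Diag.antidiagonal-box τ))

  full : ∀ τ {x y} → Δ w x (Y τ) → Δ w (X τ) y → Δ w x y
  full τ {x} {y} p q = diagram⇒Δ (Diag.antidiagonal-full τ
    (subst (λ i → (i , col x) ∈ diagram) (row-Y τ) (Δ⇒diagram p))
    (subst (λ j → (row y , j) ∈ diagram) (col-X τ) (Δ⇒diagram q)))

  private
    offset : ∀ {s m k} → s ≤ k → k < s + m → ∃ λ (i : Fin m) → k ≡ s + toℕ i
    offset {s} {m} {k} s≤k k<s+m with ℕₚ.m≤n⇒∃[o]m+o≡n s≤k
    ... | d , refl = Fin.fromℕ< d<m , cong (λ z → s + z) (sym (Finₚ.toℕ-fromℕ< d<m))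
      where d<m = ℕₚ.+-cancelˡ-< s d m k<s+m

  -- The pair places the column of `x` inside the rectangle, where each column belongs to `a` steps
  -- of the antidiagonal.
  count-X : ∀ {x y} → Δ w x y → ∑[ τ < a * b ] ⟦ X τ Finₚ.≟ x ⟧ ≡ + a
  count-X {x} {y} δ with offset (col≥ (Δ⇒diagram δ)) (col< (Δ⇒diagram δ))
  ... | j , col≡ = trans (sum-cong-≗ {a * b} λ τ → ⟦⟧-cong (X τ Finₚ.≟ x) (colOf τ Finₚ.≟ j)
      (λ { refl → Finₚ.toℕ-injective (ℕₚ.+-cancelˡ-≡ c _ _ (trans (sym (col-X τ)) col≡)) })
      (λ { refl → col-injective (trans (col-X τ) (sym col≡)) }))
    (∑-colOf j)

  count-Y : ∀ {x y} → Δ w x y → ∑[ τ < a * b ] ⟦ Y τ Finₚ.≟ y ⟧ ≡ + b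
  count-Y {x} {y} δ with offset (row≥ (Δ⇒diagram δ)) (row< (Δ⇒diagram δ))
  ... | i , row≡ = trans (sum-cong-≗ {a * b} λ τ → ⟦⟧-cong (Y τ Finₚ.≟ y) (rowOf τ Finₚ.≟ i)
      (λ { refl → Finₚ.toℕ-injective (ℕₚ.+-cancelˡ-≡ r _ _ (trans (sym (row-Y τ)) row≡)) })
      (λ { refl → row-injective (trans (row-Y τ) (sym row≡)) }))
    (∑-rowOf i)

  count : ∀ {x y} → Δ w x y → ∑[ τ < a * b ] (⟦ X τ Finₚ.≟ x ⟧ ℤ.+ ⟦ Y τ Finₚ.≟ y ⟧) ≡ + (a + b)
  count {x} {y} δ = trans (∑-distrib-+ (λ τ → ⟦ X τ Finₚ.≟ x ⟧) (λ τ → ⟦ Y τ Finₚ.≟ y ⟧))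
    (trans (cong₂ ℤ._+_ (count-X δ) (count-Y δ)) (sym (ℤₚ.pos-+ a b)))

corollary1p4 : (σ : SkewShape) (a b : ℕ)
    (size : HasHeightAndWidth (SkewShape.diagram σ) a b)
    (balanced : Balanced σ)
    (n : ℕ) (w : Permutation′ n) → SkewVexillary w σ →
    (R : Rowmotion (FinitePoset.poset [e, w ])) →
    Mesic (FinitePoset.Eq.setoid [e, w ]) (Rowmotion.row R)
    (λ u → + ddeg [e, w ] u / 1)
    (_/_ (+ (a * b)) (a + b) {{height+width≢0 σ size balanced}})
corollary1p4 σ a b size balanced n w vexillary R =
  Homomesy.ddeg-mesic w R X Y box full (a + b) count {{height+width≢0 σ size balanced}}
  where open SkewVexillaryData σ size balanced w vexillary
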